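{- Let $T$ be a complete theory with monster model $\mathcal{U}$, $M\prec\mathcal{U}$ a small elementary submodel, $\mu\in\mathfrak{M}_x(\mathcal{U})$, $\nu\in\mathfrak{M}_y(\mathcal{U})$. If $\mu$ is finitely satisfiable in $M$ and $\mu\geq_{\mathbb{E},M}\nu$, then $\nu$ is finitely satisfiable in $M$. Moreover, if $\mu$ is finitely satisfiable and $\mu\geq_{\mathbb{E}}\nu$, then $\nu$ is finitely satisfiable.
   Context: For $C\subseteq\mathcal{U}$, $\mathcal{L}_x(C)$ is the Boolean algebra of formulas in $x$ with parameters from $C$ modulo $T$, embedded in $\mathcal{L}_{xy}(C)$ via $\varphi(x)\mapsto\varphi(x)\wedge y=y$; $\mathfrak{M}_x(C)$ is the set of finitely additive probability measures on $\mathcal{L}_x(C)$. For $\omega\in\mathfrak{M}_{xy}(C)$, $\pi_x(\omega)(\varphi(x))=\omega(\varphi(x)\wedge y=y)$ (similarly $\pi_y$); $\omega|_D$ is restriction. For small $A$, $\mu\geq_{\mathbb{E},A}\nu$ means there is $\lambda\in\mathfrak{M}_{xy}(A)$ with $\pi_x(\lambda)=\mu|_A$ such that every $\omega\in\mathfrak{M}_{xy}(\mathcal{U})$ with $\omega|_A=\lambda$ and $\pi_x(\omega)=\mu$ satisfies $\pi_y(\omega)=\nu$; $\mu\geq_{\mathbb{E}}\nu$ means this for some small $A$. A global measure $\mu$ is finitely satisfiable in $M$ if every $\varphi(x)\in\mathcal{L}_x(\mathcal{U})$ with $\mu(\varphi(x))>0$ is realized by some tuple from $M$; it is finitely satisfiable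 if finitely satisfiable in some small $M\prec\mathcal{U}$. -}

module Defs where

open import Level using (Level; 0ℓ; _⊔_) renaming (suc to lsuc)
open import Data.Empty.Polymorphic using (⊥)
open import Data.Fin.Base using (Fin; zero; suc; _↑ˡ_; _↑ʳ_)
open import Data.List.Base using (List)
open import Data.List.Relation.Unary.All using (All)
open import Data.Nat.Base as ℕ using (ℕ; zero; suc)
open import Data.Product using (Σ; ∃; _×_; _,_; proj₁; proj₂; map₂)
open import Data.Rational.Base as ℚ using (ℚ; 0ℚ; 1ℚ)
import Data.Rational.Properties as ℚₚ
open import Data.Sum.Base using (_⊎_)
open import Data.Unit.Polymorphic using (⊤; tt)
open import Data.Vec.Functional using (Vector; _∷_; [])
open import Function.Base using (_∘_; id)
open import Function.Bundles using (Injection; Inverse; _⇔_)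
open import Relation.Binary.Bundles using (Poset; Setoid)
import Relation.Binary.Construct.On as On
open import Relation.Binary.Definitions using (tri<; tri≈; tri>)
open import Relation.Binary.PropositionalEquality
  using (_≡_; refl; sym; trans; cong; subst; setoid)
open import Relation.Nullary using (¬_; contradiction)
open import Relation.Unary using (Pred)

-- Taken as a hypothesis, in place of the axiom of choice.  The chain may be
-- empty.
ZornsLemma : (a b c d : Level) → Set (lsuc (a ⊔ b ⊔ c ⊔ d))
ZornsLemma a b c d = (P : Poset a b c) → let open Poset P in
  (∀ (C : Pred Carrier d) →
     (∀ x y → C x → C y → x ≤ y ⊎ y ≤ x) →
     ∃ λ u → ∀ x → C x → x ≤ u) →
  ∃ λ m → ∀ x → m ≤ x → x ≈ m

-- Lower Dedekind cuts in ℚ.  Classically every such cut is a real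
-- number; no locatedness field is included, so constructively this type
-- is larger.
record ℝ : Set₁ where
  field
    cut       : Pred ℚ 0ℓ
    inhabited : ∃ λ q → cut q
    proper    : ∃ λ q → ¬ cut q
    down      : ∀ {p q} → p ℚ.< q → cut q → cut p
    open-end  : ∀ {p} → cut p → ∃ λ q → p ℚ.< q × cut q

open ℝ public using (cut)

infix 4 _≤ᴿ_ _≈ᴿ_ _<ᴿ_

_≤ᴿ_ : ℝ → ℝ → Set
r ≤ᴿ s = ∀ q → cut r q → cut s q

_≈ᴿ_ : ℝ → ℝ → Set
r ≈ᴿ s = r ≤ᴿ s × s ≤ᴿ r

_<ᴿ_ : ℝ → ℝ → Set
r <ᴿ s = ∃ λ q → cut s q × ¬ cut r q

fromℚ : ℚ → ℝ
fromℚ r = record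
  { cut       = ℚ._< r
  ; inhabited = r ℚ.- 1ℚ , subst (r ℚ.- 1ℚ ℚ.<_) (ℚₚ.+-identityʳ r)
                  (ℚₚ.+-monoʳ-< r (ℚₚ.negative⁻¹ (ℚ.- 1ℚ)))
  ; proper    = r , ℚₚ.<-irrefl refl
  ; down      = ℚₚ.<-trans
  ; open-end  = ℚₚ.<-dense
  }

0ᴿ 1ᴿ : ℝ
0ᴿ = fromℚ 0ℚ
1ᴿ = fromℚ 1ℚ

private
  cut-below : ∀ (r : ℝ) {p q} → cut r p → ¬ cut r q → p ℚ.< q
  cut-below r {p} {q} p∈ q∉ with ℚₚ.<-cmp p q
  ... | tri< p<q _ _  = p<q
  ... | tri≈ _ refl _ = contradiction p∈ q∉
  ... | tri> _ _ q<p  = contradiction (ℝ.down r q<p p∈) q∉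

  add-sub : ∀ p q → (p ℚ.- q) ℚ.+ q ≡ p
  add-sub p q = trans (ℚₚ.+-assoc p (ℚ.- q) q)
    (trans (cong (p ℚ.+_) (ℚₚ.+-inverseˡ q)) (ℚₚ.+-identityʳ p))

  sub-add : ∀ p q → (p ℚ.+ q) ℚ.- q ≡ p
  sub-add p q = trans (ℚₚ.+-assoc p q (ℚ.- q))
    (trans (cong (p ℚ.+_) (ℚₚ.+-inverseʳ q)) (ℚₚ.+-identityʳ p))

infixl 6 _+ᴿ_

_+ᴿ_ : ℝ → ℝ → ℝ
r +ᴿ s = record
  { cut       = λ q → ∃ λ a → ∃ λ b → cut r a × cut s b × q ≡ a ℚ.+ b
  ; inhabited = let (a , a∈) = ℝ.inhabited r ; (b , b∈) = ℝ.inhabited s in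
                a ℚ.+ b , a , b , a∈ , b∈ , refl
  ; proper    = let (a , a∉) = ℝ.proper r ; (b , b∉) = ℝ.proper s in
                a ℚ.+ b , λ (c , d , c∈ , d∈ , eq) →
                  ℚₚ.<-irrefl (sym eq)
                    (ℚₚ.+-mono-< (cut-below r c∈ a∉) (cut-below s d∈ b∉))
  ; down      = λ { {p} p<q (a , b , a∈ , b∈ , refl) →
                  p ℚ.- b , b ,
                  ℝ.down r (subst (p ℚ.- b ℚ.<_) (sub-add a b)
                              (ℚₚ.+-monoˡ-< (ℚ.- b) p<q)) a∈ ,
                  b∈ , sym (add-sub p b) }
  ; open-end  = λ { (a , b , a∈ , b∈ , refl) →
                  let (c , a<c , c∈) = ℝ.open-end r a∈ in
                  c ℚ.+ b , ℚₚ.+-monoˡ-< b a<c , c , b , c∈ , b∈ , refl }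
  }

record Signature (ℓ : Level) : Set (lsuc ℓ) where
  field
    Fun : ℕ → Set ℓ
    Rel : ℕ → Set ℓ

module _ {ℓ : Level} (L : Signature ℓ) where
  open Signature L

  -- Parameters are drawn from P; the variables are Fin n.
  data Term {p} (P : Set p) (n : ℕ) : Set (ℓ ⊔ p) where
    var : Fin n → Term P n
    par : P → Term P n
    fun : ∀ {k} → Fun k → Vector (Term P n) k → Term P n

  infix  8 _≐_
  infixr 7 _∧′_
  infixr 6 _∨′_

  -- The quantifiers bind variable zero.
  data Formula {p} (P : Set p) (n : ℕ) : Set (ℓ ⊔ p) where
    _≐_       : Term P n → Term P n → Formula P n
    rel       : ∀ {k} → Rel k → Vector (Term P n) k → Formula P n
    ⊤′ ⊥′     : Formula P n
    ¬′_       : Formula P n → Formula P n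
    _∧′_ _∨′_ : Formula P n → Formula P n → Formula P n
    ∃′_ ∀′_   : Formula P (suc n) → Formula P n

  Sentence : Set ℓ
  Sentence = Formula {ℓ} ⊥ 0

  Theory : Set (lsuc ℓ)
  Theory = Pred Sentence ℓ

  -- The domain carries its own equality, which interprets ≐.
  record Structure : Set (lsuc ℓ) where
    field
      Domain   : Setoid ℓ ℓ
    open Setoid Domain public using (Carrier; _≈_)
    field
      nonempty : Carrier
      ⟦fun⟧    : ∀ {k} → Fun k → Vector Carrier k → Carrier
      ⟦rel⟧    : ∀ {k} → Rel k → Vector Carrier k → Set ℓ
      fun-cong : ∀ {k} (f : Fun k) {a b : Vector Carrier k} →
                 (∀ i → a i ≈ b i) → ⟦fun⟧ f a ≈ ⟦fun⟧ f b
      rel-resp : ∀ {k} (r : Rel k) {a b : Vector Carrier k} →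
                 (∀ i → a i ≈ b i) → ⟦rel⟧ r a → ⟦rel⟧ r b

module _ {ℓ : Level} {L : Signature ℓ} where
  open Signature L

  lift : ∀ {m n} → (Fin m → Fin n) → Fin (suc m) → Fin (suc n)
  lift f zero    = zero
  lift f (suc i) = suc (f i)

  -- Simultaneous change of parameters and renaming of variables.
  mapᵗ : ∀ {p q} {P : Set p} {Q : Set q} {m n} →
         (P → Q) → (Fin m → Fin n) → Term L P m → Term L Q n
  mapᵗ g f (var i)    = var (f i)
  mapᵗ g f (par c)    = par (g c)
  mapᵗ g f (fun h ts) = fun h (λ i → mapᵗ g f (ts i))

  mapᶠ : ∀ {p q} {P : Set p} {Q : Set q} {m n} →
         (P → Q) → (Fin m → Fin n) → Formula L P m → Formula L Q n
  mapᶠ g f (s ≐ t)    = mapᵗ g f s ≐ mapᵗ g f t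
  mapᶠ g f (rel r ts) = rel r (λ i → mapᵗ g f (ts i))
  mapᶠ g f ⊤′         = ⊤′
  mapᶠ g f ⊥′         = ⊥′
  mapᶠ g f (¬′ φ)     = ¬′ mapᶠ g f φ
  mapᶠ g f (φ ∧′ ψ)   = mapᶠ g f φ ∧′ mapᶠ g f ψ
  mapᶠ g f (φ ∨′ ψ)   = mapᶠ g f φ ∨′ mapᶠ g f ψ
  mapᶠ g f (∃′ φ)     = ∃′ mapᶠ g (lift f) φ
  mapᶠ g f (∀′ φ)     = ∀′ mapᶠ g (lift f) φ

  -- v = v for the tuple v of variables listed by f.
  selfEq : ∀ {p} {P : Set p} {k n} → (Fin k → Fin n) → Formula L P n
  selfEq {k = zero}  f = ⊤′
  selfEq {k = suc k} f = var (f zero) ≐ var (f zero) ∧′ selfEq (f ∘ suc)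

  module _ (𝒩 : Structure L) where
    open Structure 𝒩

    eval : ∀ {p} {P : Set p} {n} →
           (P → Carrier) → Vector Carrier n → Term L P n → Carrier
    eval ρ v (var i)    = v i
    eval ρ v (par c)    = ρ c
    eval ρ v (fun f ts) = ⟦fun⟧ f (λ i → eval ρ v (ts i))

    Sat : ∀ {p} {P : Set p} {n} →
          (P → Carrier) → Vector Carrier n → Formula L P n → Set ℓ
    Sat ρ v (s ≐ t)    = eval ρ v s ≈ eval ρ v t
    Sat ρ v (rel r ts) = ⟦rel⟧ r (λ i → eval ρ v (ts i))
    Sat ρ v ⊤′         = ⊤
    Sat ρ v ⊥′         = ⊥
    Sat ρ v (¬′ φ)     = ¬ Sat ρ v φ
    Sat ρ v (φ ∧′ ψ)   = Sat ρ v φ × Sat ρ v ψ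
    Sat ρ v (φ ∨′ ψ)   = Sat ρ v φ ⊎ Sat ρ v ψ
    Sat ρ v (∃′ φ)     = ∃ λ a → Sat ρ (a ∷ v) φ
    Sat ρ v (∀′ φ)     = ∀ a → Sat ρ (a ∷ v) φ

    Sat₀ : ∀ {n} → Vector Carrier n → Formula L {ℓ} ⊥ n → Set ℓ
    Sat₀ = Sat (λ ())

  _⊨_ : Structure L → Sentence L → Set ℓ
  𝒩 ⊨ σ = Sat₀ 𝒩 [] σ

  IsModel : Theory L → Structure L → Set ℓ
  IsModel T 𝒩 = ∀ σ → T σ → 𝒩 ⊨ σ

  _⊩_ : Theory L → Sentence L → Set (lsuc ℓ)
  T ⊩ σ = ∀ 𝒩 → IsModel T 𝒩 → 𝒩 ⊨ σ

  record IsComplete (T : Theory L) : Set (lsuc ℓ) where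
    field
      consistent : ∃ λ 𝒩 → IsModel T 𝒩
      decides    : ∀ σ → T ⊩ σ ⊎ T ⊩ (¬′ σ)

  module _ (𝒰 : Structure L) where
    open Structure 𝒰

    Subset : Set (lsuc ℓ)
    Subset = Pred Carrier ℓ

    full : Subset
    full _ = ⊤

    -- Membership proofs are ignored when elements are compared.
    subsetSetoid : Subset → Setoid ℓ ℓ
    subsetSetoid A = On.setoid Domain (proj₁ {B = A})

    induced : (M : Subset) → ∃ M →
              (∀ {k} (f : Fun k) (a : Vector Carrier k) →
                 (∀ i → M (a i)) → M (⟦fun⟧ f a)) →
              Structure L
    induced M pt closed = record
      { Domain   = subsetSetoid M
      ; nonempty = pt
      ; ⟦fun⟧    = λ f a → ⟦fun⟧ f (proj₁ ∘ a) , closed f (proj₁ ∘ a) (proj₂ ∘ a)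
      ; ⟦rel⟧    = λ r a → ⟦rel⟧ r (proj₁ ∘ a)
      ; fun-cong = λ f a≈b → fun-cong f a≈b
      ; rel-resp = λ r a≈b → rel-resp r a≈b
      }

    record IsElementarySubmodel (M : Subset) : Set ℓ where
      field
        point      : ∃ M
        closed     : ∀ {k} (f : Fun k) (a : Vector Carrier k) →
                     (∀ i → M (a i)) → M (⟦fun⟧ f a)
        elementary : ∀ {n} (φ : Formula L ⊥ n) (a : Vector (∃ M) n) →
                     Sat₀ (induced M point closed) a φ ⇔ Sat₀ 𝒰 (proj₁ ∘ a) φ

  -- |S| < |κ|; only the cardinality of the type κ is used.
  _<ᶜ_ : Setoid ℓ ℓ → Set ℓ → Set ℓ
  S <ᶜ κ = Injection S (setoid κ) × ¬ Injection (setoid κ) S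

  -- A type of cardinality |L| + ℵ₀.
  LanguageSize : Set ℓ
  LanguageSize = (∃ Fun ⊎ ∃ Rel) ⊎ ℕ

  module _ (𝒰 : Structure L) where
    open Structure 𝒰

    IsSmall : Set ℓ → Subset 𝒰 → Set ℓ
    IsSmall κ A = subsetSetoid 𝒰 A <ᶜ κ

    -- Representatives; the Boolean algebra is 𝓛 C n up to _∼_ below.
    𝓛 : Subset 𝒰 → ℕ → Set ℓ
    𝓛 C n = Formula L (∃ C) n

    Realizes : ∀ {C n} → Vector Carrier n → 𝓛 C n → Set ℓ
    Realizes a φ = Sat 𝒰 proj₁ a φ

    -- Equivalence modulo T with parameters from C.  As T is complete and the
    -- parameters are named, this is having the same solutions in 𝒰.
    _∼_ : ∀ {C n} → 𝓛 C n → 𝓛 C n → Set ℓ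
    φ ∼ ψ = ∀ a → Realizes a φ ⇔ Realizes a ψ

    IsSaturated : Set ℓ → Set (lsuc ℓ)
    IsSaturated κ = ∀ (A : Subset 𝒰) → IsSmall κ A →
      ∀ {n} (p : Pred (𝓛 A n) ℓ) →
      (∀ (φs : List (𝓛 A n)) → All p φs → ∃ λ a → All (Realizes a) φs) →
      ∃ λ a → ∀ φ → p φ → Realizes a φ

    record Automorphism : Set ℓ where
      field
        bijection : Inverse Domain Domain
      open Inverse bijection public using (to)
      field
        fun-hom : ∀ {k} (f : Fun k) (a : Vector Carrier k) →
                  to (⟦fun⟧ f a) ≈ ⟦fun⟧ f (to ∘ a)
        rel-hom : ∀ {k} (r : Rel k) (a : Vector Carrier k) →
                  ⟦rel⟧ r a ⇔ ⟦rel⟧ r (to ∘ a)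

    IsStronglyHomogeneous : Set ℓ → Set (lsuc ℓ)
    IsStronglyHomogeneous κ = ∀ (A : Subset 𝒰) → IsSmall κ A →
      ∀ (f : ∃ A → Carrier) →
      (∀ {n} (φ : Formula L ⊥ n) (a : Vector (∃ A) n) →
         Sat₀ 𝒰 (proj₁ ∘ a) φ ⇔ Sat₀ 𝒰 (f ∘ a) φ) →
      ∃ λ (σ : Automorphism) → ∀ a → Automorphism.to σ (proj₁ a) ≈ f a

    record IsMonster (T : Theory L) (κ : Set ℓ) : Set (lsuc ℓ) where
      field
        model       : IsModel T 𝒰
        large       : setoid LanguageSize <ᶜ κ
        saturated   : IsSaturated κ
        homogeneous : IsStronglyHomogeneous κ

    -- Values lie in [0 , 1]: nonnegativity, total mass 1 and additivity
    -- bound them above.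
    record 𝔐 (C : Subset 𝒰) (n : ℕ) : Set (lsuc 0ℓ ⊔ ℓ) where
      field
        ⟪_⟫      : 𝓛 C n → ℝ
        ∼-cong   : ∀ {φ ψ} → φ ∼ ψ → ⟪ φ ⟫ ≈ᴿ ⟪ ψ ⟫
        nonneg   : ∀ φ → 0ᴿ ≤ᴿ ⟪ φ ⟫
        total    : ⟪ ⊤′ ⟫ ≈ᴿ 1ᴿ
        additive : ∀ φ ψ → (φ ∧′ ψ) ∼ ⊥′ → ⟪ φ ∨′ ψ ⟫ ≈ᴿ ⟪ φ ⟫ +ᴿ ⟪ ψ ⟫

    open 𝔐 public using (⟪_⟫)

    infix 4 _≋_

    _≋_ : ∀ {C n} → (𝓛 C n → ℝ) → (𝓛 C n → ℝ) → Set ℓ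
    μ ≋ ν = ∀ φ → μ φ ≈ᴿ ν φ

    restrict : ∀ A {n} → (𝓛 (full 𝒰) n → ℝ) → (𝓛 A n → ℝ)
    restrict A μ φ = μ (mapᶠ (map₂ (λ _ → tt)) id φ)

    -- In 𝓛 C (m + n) the tuple x is the first m variables and y is the
    -- last n.
    πˣ : ∀ {C} m n → (𝓛 C (m ℕ.+ n) → ℝ) → (𝓛 C m → ℝ)
    πˣ m n ω φ = ω (mapᶠ id (_↑ˡ n) φ ∧′ selfEq {k = n} (m ↑ʳ_))

    πʸ : ∀ {C} m n → (𝓛 C (m ℕ.+ n) → ℝ) → (𝓛 C n → ℝ)
    πʸ m n ω φ = ω (selfEq {k = m} (_↑ˡ n) ∧′ mapᶠ id (m ↑ʳ_) φ)

    -- GeqE A μ ν is μ ≥𝔼,A ν, and GeqESmall is μ ≥𝔼 ν, where smallness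
    -- is relative to κ.
    GeqE : Subset 𝒰 → ∀ {m n} → 𝔐 (full 𝒰) m → 𝔐 (full 𝒰) n → Set (lsuc 0ℓ ⊔ ℓ)
    GeqE A {m} {n} μ ν =
      ∃ λ (λ′ : 𝔐 A (m ℕ.+ n)) →
        πˣ m n ⟪ λ′ ⟫ ≋ restrict A ⟪ μ ⟫ ×
        (∀ (ω : 𝔐 (full 𝒰) (m ℕ.+ n)) →
           restrict A ⟪ ω ⟫ ≋ ⟪ λ′ ⟫ →
           πˣ m n ⟪ ω ⟫ ≋ ⟪ μ ⟫ →
           πʸ m n ⟪ ω ⟫ ≋ ⟪ ν ⟫)

    GeqESmall : Set ℓ → ∀ {m n} → 𝔐 (full 𝒰) m → 𝔐 (full 𝒰) n →
                Set (lsuc 0ℓ ⊔ lsuc ℓ)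
    GeqESmall κ μ ν = ∃ λ A → IsSmall κ A × GeqE A μ ν

    FinSatIn : Subset 𝒰 → ∀ {n} → 𝔐 (full 𝒰) n → Set ℓ
    FinSatIn M {n} μ = ∀ (φ : 𝓛 (full 𝒰) n) → 0ᴿ <ᴿ ⟪ μ ⟫ φ →
      ∃ λ (a : Vector (∃ M) n) → Realizes (proj₁ ∘ a) φ

    FinSat : Set ℓ → ∀ {n} → 𝔐 (full 𝒰) n → Set (lsuc ℓ)
    FinSat κ μ = ∃ λ M →
      IsSmall κ M × IsElementarySubmodel 𝒰 M × FinSatIn M μ

-- Both claims follow from one: if A ⊆ M, M is an elementary submodel in which
-- μ is finitely satisfiable, and μ ≥𝔼,A ν is witnessed by a measure λ over A,
-- then ν is finitely satisfiable in M.  For this it suffices to extend λ and μ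
-- to a global measure ω in (x , y) that is finitely satisfiable in M, since
-- then ν = πʸ ω.  The second claim needs in addition a small elementary
-- submodel that contains A and M (Löwenheim–Skolem).
--
-- Let X be the set of (x , y)-tuples from M.  The functions X → ℚ that dominate
-- a sum of functions φ - q with q < λ(φ) and ψ - r with r < μ(ψ) form a convex
-- cone.  A maximal proper cone P containing it is total, and ω(χ) is the
-- supremum of all q with χ - q ∈ P.
--
-- That the cone is proper means that ∑ λ(φᵢ) + ∑ μ(ψⱼ) is at most the value of
-- ∑ φᵢ + ∑ ψⱼ at some point of X.  Replacing pairs φ, φ′ with φ ∨ φ′, φ ∧ φ′
-- one may take the φᵢ to be descending.  As λ(φᵢ) ≤ μ(∃ y φᵢ), and as the φᵢ
-- are descending, every x in M extends to some (x , y) that satisfies each φᵢ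
-- for which x satisfies ∃ y φᵢ, so only formulas in x are left.  Make these
-- descending, too: some x in M satisfies all of them that are satisfiable in
-- M, and the others have μ-measure 0.

module Submission where

open import Defs
open import Level using (0ℓ; _⊔_) renaming (suc to lsuc)
open import Algebra.Bundles using (CommutativeMonoid)
open import Axiom.ExcludedMiddle using (ExcludedMiddle)
open import Data.Bool.Base using (Bool; true; false)
open import Data.Empty using (⊥; ⊥-elim)
import Data.Empty.Polymorphic as Poly
open import Data.Fin.Base using (Fin; zero; suc; _↑ˡ_; _↑ʳ_; splitAt; toℕ)
open import Data.Fin.Properties using (splitAt⁻¹-↑ˡ; splitAt⁻¹-↑ʳ)
open import Data.Integer.Base as ℤ using (+_)
import Data.Integer.Properties as ℤₚ
open import Data.List.Base as List using (List; concat; tabulate; length; map; foldr)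
  renaming (_∷_ to _∷ˡ_; [] to []ˡ; _++_ to _++ˡ_)
open import Data.List.Membership.Propositional using (_∈_)
open import Data.List.Membership.Propositional.Properties
  using (∈-concat⁺′; ∈-tabulate⁺; ∈-++⁺ˡ; ∈-++⁺ʳ)
open import Data.List.Relation.Unary.All as All using (All) renaming ([] to []ᴬ; _∷_ to _∷ᴬ_)
open import Data.List.Relation.Unary.AllPairs as AllPairs using (AllPairs)
  renaming ([] to []ᴾ; _∷_ to _∷ᴾ_)
open import Data.List.Relation.Unary.Any as Any using (here)
open import Data.List.Relation.Unary.Any.Properties using (lookup-index)
open import Data.Nat.Base as ℕ using (ℕ; zero; suc)
import Data.Nat.Properties as ℕₚ
open import Data.Product using (∃; _×_; _,_; proj₁; proj₂; -,_; map₂)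
open import Data.Product.Function.NonDependent.Propositional using (_×-⇔_)
open import Data.Rational.Base as ℚ using (ℚ; 0ℚ; 1ℚ; ½; toℚᵘ)
import Data.Rational.Properties as ℚₚ
open import Data.Rational.Solver using (module +-*-Solver)
import Data.Rational.Unnormalised.Base as ℚᵘ
import Data.Rational.Unnormalised.Properties as ℚᵘₚ
open import Data.Sum.Base using (_⊎_; inj₁; inj₂; [_,_]′)
open import Data.Sum.Function.Propositional using (_⊎-⇔_)
open import Data.Sum.Properties using (inj₂-injective)
import Data.Unit.Polymorphic as Poly
open import Data.Vec.Functional using (Vector; _∷_; []; _++_)
open import Data.Vec.Functional.Properties using (lookup-++ˡ; lookup-++ʳ)
open import Function.Base using (_∘_; id)
open import Function.Bundles using (_⇔_; mk⇔; Equivalence; Injection)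
open import Function.Construct.Composition using (_⇔-∘_)
open import Function.Construct.Identity using (⇔-id)
open import Function.Construct.Symmetry using (⇔-sym)
open import Function.Related.TypeIsomorphisms using (¬-cong-⇔)
open import Relation.Binary.Bundles using (Poset; Setoid)
open import Relation.Binary.PropositionalEquality
  using (_≡_; _≢_; refl; sym; trans; cong; cong₂; subst; subst₂; setoid)
import Relation.Binary.Reasoning.Setoid as SetoidReasoning
open import Relation.Nullary using (¬_; yes; no; contradiction)
open import Relation.Nullary.Decidable using (True; toWitness; fromWitness; decidable-stable)
open import Relation.Unary using (Pred; _⊆_; U; ∅)

open +-*-Solver using (solve; _:+_; _:*_; _:-_; :-_; _:=_; con)
open Equivalence using (to; from)

-- Zorn's lemma

module Classical (em : ∀ {a} → ExcludedMiddle a) (zorn : ∀ {a b c d} → ZornsLemma a b c d) where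

  -- Excluded middle makes every proposition equivalent to one in Set₀, which
  -- gives unions of chains the level of their members.
  ⌊_⌋ : ∀ {a} → Set a → Set
  ⌊ A ⌋ = True (em {P = A})

  ⌈_⌉ : ∀ {a} {A : Set a} → ⌊ A ⌋ → A
  ⌈_⌉ = toWitness

  ⌊⌋-intro : ∀ {a} {A : Set a} → A → ⌊ A ⌋
  ⌊⌋-intro = fromWitness

  by-contradiction : ∀ {a} {A : Set a} → ¬ ¬ A → A
  by-contradiction = decidable-stable em

  module _ {w φ} {W : Set w} (Φ : Pred W 0ℓ → W → W → Set φ) where

    -- Conditions on pairs survive unions of chains: two members of the union lie in a common link,
    -- and `Φ-mono` passes from the link to the union. As `Φ` may mention the set itself, closure
    -- conditions can be expressed as well.
    Coherent : Pred W 0ℓ → Set (w ⊔ φ)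
    Coherent R = ∀ {x y} → R x → R y → Φ R x y

    module _ (Φ-mono : ∀ {R S} → R ⊆ S → ∀ {x y} → Φ R x y → Φ S x y)
             {R₀ : Pred W 0ℓ} (coherent₀ : Coherent R₀) where

      private
        Ext : Set (w ⊔ lsuc 0ℓ ⊔ φ)
        Ext = ∃ λ R → R₀ ⊆ R × Coherent R

        extensions : Poset (w ⊔ lsuc 0ℓ ⊔ φ) w w
        extensions = record
          { Carrier = Ext
          ; _≈_     = λ (R , _) (S , _) → R ⊆ S × S ⊆ R
          ; _≤_     = λ (R , _) (S , _) → R ⊆ S
          ; isPartialOrder = record
            { isPreorder = record
              { isEquivalence = record
                { refl  = id , id
                ; sym   = λ (f , g) → g , f
                ; trans = λ (f , g) (f′ , g′) → f′ ∘ f , g ∘ g′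
                }
              ; reflexive = proj₁
              ; trans     = λ f g → g ∘ f
              }
            ; antisym = _,_
            }
          }

        module _ (C : Pred Ext 0ℓ)
                 (chain : ∀ x y → C x → C y →
                          proj₁ x ⊆ proj₁ y ⊎ proj₁ y ⊆ proj₁ x) where

          ⋃ : Pred W 0ℓ
          ⋃ z = ⌊ ∃ (λ R → C R × proj₁ R z) ⌋

          ∈-⋃ : ∀ {R} → C R → proj₁ R ⊆ ⋃
          ∈-⋃ c r = ⌊⌋-intro (-, c , r)

          ⋃-coherent : Coherent ⋃
          ⋃-coherent x∈ y∈ with ⌈ x∈ ⌉ | ⌈ y∈ ⌉
          ... | R , cR , x∈R | S , cS , y∈S with chain R S cR cS
          ...   | inj₁ R⊆S = Φ-mono (∈-⋃ cS) (proj₂ (proj₂ S) (R⊆S x∈R) y∈S)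
          ...   | inj₂ S⊆R = Φ-mono (∈-⋃ cR) (proj₂ (proj₂ R) x∈R (S⊆R y∈S))

          upper-bound : ∃ λ (U : Ext) → ∀ R → C R → proj₁ R ⊆ proj₁ U
          upper-bound with em {P = ∃ C}
          -- The union of the empty chain need not contain `R₀`, so `R₀` itself is the bound here.
          ... | no  empty    = (R₀ , id , coherent₀) , λ R cR → ⊥-elim (empty (R , cR))
          ... | yes (R , cR) =
            (⋃ , ∈-⋃ cR ∘ proj₁ (proj₂ R) , ⋃-coherent) , λ _ → ∈-⋃

      maximal : ∃ λ R → R₀ ⊆ R × Coherent R × (∀ {S} → R ⊆ S → Coherent S → S ⊆ R)
      maximal with zorn {d = 0ℓ} extensions upper-bound
      ... | (R , R₀⊆R , cohR) , max =
        R , R₀⊆R , cohR , λ R⊆S cohS →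
          proj₁ (max (_ , R⊆S ∘ R₀⊆R , cohS) R⊆S)

  module _ {w e} {W : Set w} (E : W → W → Set e) where

    Clique : Pred W 0ℓ → Set (w ⊔ e)
    Clique = Coherent (λ _ → E)

    -- The relation `E` does not mention the set, so monotonicity is trivial and the empty set is a
    -- coherent start. Maximality, applied to `R` with `z` adjoined, reduces to the loop at `z` and
    -- the edges between `z` and `R`.
    maximal-clique : ∃ λ R → Clique R ×
      (∀ z → E z z → (∀ {x} → R x → E x z × E z x) → R z)
    maximal-clique
      with maximal (λ _ → E) (λ _ e → e) {∅} (λ ())
    ... | R , _ , clique , max = R , clique , λ z zz compat →
      max {S = λ x → R x ⊎ ⌊ x ≡ z ⌋} inj₁
        (λ { (inj₁ x∈) (inj₁ y∈) → clique x∈ y∈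
           ; (inj₁ x∈) (inj₂ y≡) → subst (E _) (sym ⌈ y≡ ⌉) (proj₁ (compat x∈))
           ; (inj₂ x≡) (inj₁ y∈) → subst (λ x → E x _) (sym ⌈ x≡ ⌉) (proj₂ (compat y∈))
           ; (inj₂ x≡) (inj₂ y≡) →
               subst (λ x → E x _) (sym ⌈ x≡ ⌉) (subst (E z) (sym ⌈ y≡ ⌉) zz) })
        (inj₂ (⌊⌋-intro refl))

-- Cardinal arithmetic

-- This is 2^i (2j + 1).
pair : ℕ → ℕ → ℕ
pair zero    j = suc (j ℕ.+ j)
pair (suc i) j = pair i j ℕ.+ pair i j

double-injective : ∀ i j → i ℕ.+ i ≡ j ℕ.+ j → i ≡ j
double-injective zero    zero    _  = refl
double-injective (suc i) (suc j) eq = cong suc (double-injective i j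
  (ℕₚ.suc-injective (trans (sym (ℕₚ.+-suc i i))
    (trans (ℕₚ.suc-injective eq) (ℕₚ.+-suc j j)))))

odd≢even : ∀ i j → suc (i ℕ.+ i) ≢ j ℕ.+ j
odd≢even zero    (suc j) eq with trans (ℕₚ.suc-injective eq) (ℕₚ.+-suc j j)
... | ()
odd≢even (suc i) (suc j) eq = odd≢even i j
  (ℕₚ.suc-injective (trans (cong suc (sym (ℕₚ.+-suc i i)))
    (trans (ℕₚ.suc-injective eq) (ℕₚ.+-suc j j))))

pair-injective : ∀ i j i′ j′ → pair i j ≡ pair i′ j′ → i ≡ i′ × j ≡ j′
pair-injective zero    j zero     j′ eq = refl , double-injective j j′ (ℕₚ.suc-injective eq)
pair-injective zero    j (suc i′) j′ eq = contradiction eq (odd≢even j (pair i′ j′))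
pair-injective (suc i) j zero     j′ eq = contradiction (sym eq) (odd≢even j′ (pair i j))
pair-injective (suc i) j (suc i′) j′ eq =
  let i≡i′ , j≡j′ = pair-injective i j i′ j′ (double-injective (pair i j) (pair i′ j′) eq)
  in cong suc i≡i′ , j≡j′

module Cardinals (em : ∀ {a} → ExcludedMiddle a) (zorn : ∀ {a b c d} → ZornsLemma a b c d) where
  open Classical em zorn

  -- Hilbert's choice operator. Since `∃ P` is a type of pairs, deciding it by excluded middle
  -- yields a witness whenever there is one; `d` is the default.
  ε : ∀ {a p} {A : Set a} → Pred A p → A → A
  ε P d with em {P = ∃ P}
  ... | yes (x , _) = x
  ... | no  _       = d

  ε-spec : ∀ {a p} {A : Set a} (P : Pred A p) {d} → ∃ P → P (ε P d)
  ε-spec P ∃P with em {P = ∃ P}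
  ... | yes (_ , p) = p
  ... | no  ∄P      = ⊥-elim (∄P ∃P)

  module _ {k} {K : Set k} where

    infix 4 _≼_

    _≼_ : ∀ {a b} → Pred K a → Pred K b → Set (k ⊔ a ⊔ b)
    S ≼ T = ∃ λ (f : K → K) →
      (∀ {x} → S x → T (f x)) × (∀ {x y} → S x → S y → f x ≡ f y → x ≡ y)

    ≼-refl : ∀ {a} {S : Pred K a} → S ≼ S
    ≼-refl = id , id , λ _ _ eq → eq

    ≼-trans : ∀ {a b c} {S : Pred K a} {T : Pred K b} {U : Pred K c} →
              S ≼ T → T ≼ U → S ≼ U
    ≼-trans (f , f∈ , f-inj) (g , g∈ , g-inj) =
      g ∘ f , g∈ ∘ f∈ , λ x∈ y∈ eq → f-inj x∈ y∈ (g-inj (f∈ x∈) (f∈ y∈) eq)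

    -- A maximal clique of the relation below is a maximal partial injection from `S` to `T`. If it
    -- is defined on all of `S`, it embeds `S` in `T`; otherwise its inverse embeds `T` in `S`.
    ≼-total : ∀ {a b} (S : Pred K a) (T : Pred K b) → S ≼ T ⊎ T ≼ S
    ≼-total S T with maximal-clique {W = K × K} (λ (x , y) (x′ , y′) →
                       (S x × T y) × (x ≡ x′ → y ≡ y′) × (y ≡ y′ → x ≡ x′))
    ... | R , clique , max with em {P = ∃ λ x → S x × ¬ ∃ λ y → R (x , y)}
    ...   | no  total =
        inj₁ ( (λ x → ε (λ y → R (x , y)) x)
             , (λ x∈ → let r = f-spec x∈ in proj₂ (proj₁ (clique r r)))
             , λ x∈ y∈ eq → proj₂ (proj₂ (clique (f-spec x∈) (f-spec y∈))) eq)
        where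
        f-spec : ∀ {x} → S x → R (x , ε (λ y → R (x , y)) x)
        f-spec {x} x∈ = ε-spec (λ y → R (x , y)) (by-contradiction λ ∄ → total (x , x∈ , ∄))
    ...   | yes (x₀ , x₀∈ , ∄) =
        inj₂ ( (λ y → ε (λ x → R (x , y)) y)
             , (λ y∈ → let r = g-spec y∈ in proj₁ (proj₁ (clique r r)))
             , λ x∈ y∈ eq → proj₁ (proj₂ (clique (g-spec x∈) (g-spec y∈))) eq)
        where
        g-spec : ∀ {y} → T y → R (ε (λ x → R (x , y)) y , y)
        -- If `y` were unmatched like `x₀`, the pair `(x₀ , y)` could be added.
        g-spec {y} y∈ = ε-spec (λ x → R (x , y)) (by-contradiction λ ∄x →
          ∄ (y , max (x₀ , y) ((x₀∈ , y∈) , (λ _ → refl) , (λ _ → refl)) λ {(x , y′)} r →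
            (proj₁ (clique r r)
              , (λ { refl → ⊥-elim (∄ (y′ , r)) })
              , (λ { refl → ⊥-elim (∄x (x , r)) }))
            , (x₀∈ , y∈)
              , (λ { refl → ⊥-elim (∄ (y′ , r)) })
              , (λ { refl → ⊥-elim (∄x (x , r)) })))

    record Pairing {b} (B : Pred K b) : Set (k ⊔ b) where
      field
        ⟨_,_⟩     : K → K → K
        closed    : ∀ {x y} → B x → B y → B ⟨ x , y ⟩
        injective : ∀ {x y x′ y′} → B x → B y → B x′ → B y′ →
                    ⟨ x , y ⟩ ≡ ⟨ x′ , y′ ⟩ → x ≡ x′ × y ≡ y′

    ≼-pairing : ∀ {a b} {B : Pred K b} {D : Pred K a} →
                D ⊆ B → B ≼ D → Pairing D → Pairing B
    ≼-pairing D⊆B (h , h∈ , h-inj) p = record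
      { ⟨_,_⟩     = λ x y → ⟨ h x , h y ⟩
      ; closed    = λ x∈ y∈ → D⊆B (closed (h∈ x∈) (h∈ y∈))
      ; injective = λ x∈ y∈ x′∈ y′∈ eq →
          let eq₁ , eq₂ = injective (h∈ x∈) (h∈ y∈) (h∈ x′∈) (h∈ y′∈) eq
          in h-inj x∈ x′∈ eq₁ , h-inj y∈ y′∈ eq₂
      }
      where open Pairing p

    module _ {b} (B : Pred K b) (ν : ℕ → K) (ν∈B : ∀ i → B (ν i))
             (ν-inj : ∀ {i j} → ν i ≡ ν j → i ≡ j) where

      private
        -- A coherent set of triples is the graph of an injective pairing on
        -- the subset of B consisting of the entries of its triples.
        Φ : Pred (K × K × K) 0ℓ → K × K × K → K × K × K → Set (k ⊔ b)
        Φ R (x , y , z) (x′ , y′ , z′) =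
          B x × (∃ λ w → R (y , y , w)) × (∃ λ w → R (z , z , w)) ×
          (∃ λ w → R (x , x′ , w)) ×
          (x ≡ x′ → y ≡ y′ → z ≡ z′) × (z ≡ z′ → x ≡ x′ × y ≡ y′)

        Φ-mono : ∀ {R S} → R ⊆ S → ∀ {s t} → Φ R s t → Φ S s t
        Φ-mono R⊆S (b , (_ , r₁) , (_ , r₂) , (_ , r₃) , det , inj) =
          b , (-, R⊆S r₁) , (-, R⊆S r₂) , (-, R⊆S r₃) , det , inj

        -- The pairing of the natural numbers, carried over to the range of `ν`. Starting from it
        -- keeps this range inside the domain of the maximal pairing, where its elements serve as
        -- tags.
        R₀ : Pred (K × K × K) 0ℓ
        R₀ t = ⌊ ∃ (λ i → ∃ λ j → t ≡ (ν i , ν j , ν (pair i j))) ⌋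

        R₀-intro : ∀ i j → R₀ (ν i , ν j , ν (pair i j))
        R₀-intro i j = ⌊⌋-intro (i , j , refl)

        R₀-coherent : Coherent Φ R₀
        R₀-coherent r s with ⌈ r ⌉ | ⌈ s ⌉
        ... | i , j , refl | i′ , j′ , refl =
          ν∈B i , (-, R₀-intro j j) , (-, R₀-intro (pair i j) (pair i j)) ,
          (-, R₀-intro i i′) ,
          (λ eq₁ eq₂ → cong ν (cong₂ pair (ν-inj eq₁) (ν-inj eq₂))) ,
          λ eq → let eq₁ , eq₂ = pair-injective i j i′ j′ (ν-inj eq)
                 in cong ν eq₁ , cong ν eq₂

      module MaximalGraph {R : Pred (K × K × K) 0ℓ} (R₀⊆R : R₀ ⊆ R) (R-coh : Coherent Φ R)
               (R-max : ∀ {S} → R ⊆ S → Coherent Φ S → S ⊆ R) where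

        -- By coherence every entry of a triple in `R` occurs on the diagonal, so the diagonal alone
        -- describes the domain of the pairing.
        D : Pred K k
        D x = ∃ λ w → R (x , x , w)

        D⊆B : D ⊆ B
        D⊆B (_ , r) = proj₁ (R-coh r r)

        f : K → K → K
        f x y = ε (λ w → R (x , y , w)) x

        f-spec : ∀ {x y} → D x → D y → R (x , y , f x y)
        f-spec {x} {y} (_ , r) (_ , s) =
          ε-spec (λ w → R (x , y , w)) (proj₁ (proj₂ (proj₂ (proj₂ (R-coh r s)))))

        D₁ : ∀ {x y z} → R (x , y , z) → D x
        D₁ r = proj₁ (proj₂ (proj₂ (proj₂ (R-coh r r))))

        D₂ : ∀ {x y z} → R (x , y , z) → D y
        D₂ r = proj₁ (proj₂ (R-coh r r))

        D₃ : ∀ {x y z} → R (x , y , z) → D z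
        D₃ r = proj₁ (proj₂ (proj₂ (R-coh r r)))

        R-det : ∀ {x y z z′} → R (x , y , z) → R (x , y , z′) → z ≡ z′
        R-det r s = proj₁ (proj₂ (proj₂ (proj₂ (proj₂ (R-coh r s))))) refl refl

        R-inj : ∀ {x y x′ y′ z z′} → R (x , y , z) → R (x′ , y′ , z′) →
                z ≡ z′ → x ≡ x′ × y ≡ y′
        R-inj r s = proj₂ (proj₂ (proj₂ (proj₂ (proj₂ (R-coh r s)))))

        D-pairing : Pairing D
        D-pairing = record
          { ⟨_,_⟩     = f
          ; closed    = λ x∈ y∈ → D₃ (f-spec x∈ y∈)
          ; injective = λ x∈ y∈ x′∈ y′∈ → R-inj (f-spec x∈ y∈) (f-spec x′∈ y′∈)
          }

        ν∈D : ∀ i → D (ν i)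
        ν∈D i = -, R₀⊆R (R₀-intro i i)

        -- If D embeds into its complement, then the pairing extends to the
        -- union of D with its image.
        module Enlarge {g : K → K} (g∈ : ∀ {x} → D x → B (g x) × ¬ D (g x))
                       (g-inj : ∀ {x y} → D x → D y → g x ≡ g y → x ≡ y) where

          e : Bool → K → K
          e false x = x
          e true  x = g x

          e∈B : ∀ s {x} → D x → B (e s x)
          e∈B false x∈ = D⊆B x∈
          e∈B true  x∈ = proj₁ (g∈ x∈)

          e-inj : ∀ s t {x y} → D x → D y → e s x ≡ e t y → s ≡ t × x ≡ y
          e-inj false false x∈ y∈ eq = refl , eq
          e-inj false true  x∈ y∈ eq = contradiction (subst D eq x∈) (proj₂ (g∈ y∈))
          e-inj true  false x∈ y∈ eq = contradiction (subst D (sym eq) y∈) (proj₂ (g∈ x∈))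
          e-inj true  true  x∈ y∈ eq = refl , g-inj x∈ y∈ eq

          tag : Bool → Bool → ℕ
          tag false false = 0
          tag false true  = 1
          tag true  false = 2
          tag true  true  = 3

          untag : ℕ → Bool × Bool
          untag 0 = false , false
          untag 1 = false , true
          untag 2 = true  , false
          untag _ = true  , true

          untag-tag : ∀ s t → untag (tag s t) ≡ (s , t)
          untag-tag false false = refl
          untag-tag false true  = refl
          untag-tag true  false = refl
          untag-tag true  true  = refl

          -- Index zero leaves a value in `D`, so on `D` the new pairing agrees with `f`. The other
          -- three quadrants go to the image of `g`, where the tag `ν i` keeps them disjoint.
          c : ℕ → K → K
          c zero    z = z
          c (suc i) z = g (f (ν i) z)

          f∈D : ∀ {x y} → D x → D y → D (f x y)
          f∈D = Pairing.closed D-pairing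

          c-inj : ∀ i j {z w} → D z → D w → c i z ≡ c j w → i ≡ j × z ≡ w
          c-inj zero    zero    z∈ w∈ eq = refl , eq
          c-inj zero    (suc j) z∈ w∈ eq =
            contradiction (subst D eq z∈) (proj₂ (g∈ (f∈D (ν∈D j) w∈)))
          c-inj (suc i) zero    z∈ w∈ eq =
            contradiction (subst D (sym eq) w∈) (proj₂ (g∈ (f∈D (ν∈D i) z∈)))
          c-inj (suc i) (suc j) z∈ w∈ eq =
            let eq₁ , eq₂ = Pairing.injective D-pairing (ν∈D i) z∈ (ν∈D j) w∈
                              (g-inj (f∈D (ν∈D i) z∈) (f∈D (ν∈D j) w∈) eq)
            in cong suc (ν-inj eq₁) , eq₂

          c∈ : ∀ i {z} → D z → ∃ λ s → ∃ λ w → D w × e s w ≡ c i z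
          c∈ zero    z∈ = false , -, z∈ , refl
          c∈ (suc i) z∈ = true , -, f∈D (ν∈D i) z∈ , refl

          data Graph : K × K × K → Set k where
            graph : ∀ s t {x y} → D x → D y →
                    Graph (e s x , e t y , c (tag s t) (f x y))

          S : Pred (K × K × K) 0ℓ
          S t = ⌊ Graph t ⌋

          diagonal : ∀ s {x} → D x → ∃ λ w → S (e s x , e s x , w)
          diagonal s x∈ = -, ⌊⌋-intro (graph s s x∈ x∈)

          S-coherent : Coherent Φ S
          S-coherent p q with ⌈ p ⌉ | ⌈ q ⌉
          ... | graph s t {x} {y} x∈ y∈ | graph s′ t′ {x′} {y′} x′∈ y′∈ =
            e∈B s x∈ , diagonal t y∈ , diagonal-c (c∈ (tag s t) (f∈D x∈ y∈)) ,
            (-, ⌊⌋-intro (graph s s′ x∈ x′∈)) , det , inj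
            where
            diagonal-c : ∀ {u} → (∃ λ s → ∃ λ w → D w × e s w ≡ u) →
                         ∃ λ w → S (u , u , w)
            diagonal-c (s , _ , w∈ , refl) = diagonal s w∈

            det : e s x ≡ e s′ x′ → e t y ≡ e t′ y′ →
                  c (tag s t) (f x y) ≡ c (tag s′ t′) (f x′ y′)
            det eq₁ eq₂ with e-inj s s′ x∈ x′∈ eq₁ | e-inj t t′ y∈ y′∈ eq₂
            ... | refl , refl | refl , refl = refl

            inj : c (tag s t) (f x y) ≡ c (tag s′ t′) (f x′ y′) →
                  e s x ≡ e s′ x′ × e t y ≡ e t′ y′
            inj eq =
              let eq₁ , eq₂ = c-inj (tag s t) (tag s′ t′) (f∈D x∈ y∈) (f∈D x′∈ y′∈) eq
                  eq₃ , eq₄ = R-inj (f-spec x∈ y∈) (f-spec x′∈ y′∈) eq₂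
                  eq₅ = trans (sym (untag-tag s t)) (trans (cong untag eq₁) (untag-tag s′ t′))
              in cong₂ e (cong proj₁ eq₅) eq₃ , cong₂ e (cong proj₂ eq₅) eq₄

          R⊆S : R ⊆ S
          R⊆S {x , y , z} r = subst (λ z → S (x , y , z)) (R-det (f-spec (D₁ r) (D₂ r)) r)
            (⌊⌋-intro (graph false false (D₁ r) (D₂ r)))

          impossible : ⊥
          -- The diagonal triple at `g (ν 0)` lies in `S`, so maximality of `R` puts `g (ν 0)` into
          -- `D`.
          impossible = proj₂ (g∈ (ν∈D 0))
            (D₁ (R-max R⊆S S-coherent (⌊⌋-intro (graph true true (ν∈D 0) (ν∈D 0)))))

        -- Both `D` and its complement in `B` are mapped into `D` by means of `f`; the first
        -- coordinates `ν 0` and `ν 1` keep the two images apart.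
        B≼D : (λ x → B x × ¬ D x) ≼ D → B ≼ D
        B≼D (g , g∈ , g-inj) = h , h∈ , h-inj
          where
          h : K → K
          h x with em {P = D x}
          ... | yes _ = f (ν 0) x
          ... | no  _ = f (ν 1) (g x)

          h∈ : ∀ {x} → B x → D (h x)
          h∈ {x} x∈ with em {P = D x}
          ... | yes d = Pairing.closed D-pairing (ν∈D 0) d
          ... | no ¬d = Pairing.closed D-pairing (ν∈D 1) (g∈ (x∈ , ¬d))

          h-inj : ∀ {x y} → B x → B y → h x ≡ h y → x ≡ y
          h-inj {x} {y} x∈ y∈ eq with em {P = D x} | em {P = D y}
          ... | yes d | yes e = proj₂ (Pairing.injective D-pairing (ν∈D 0) d (ν∈D 0) e eq)
          ... | yes d | no ¬e with
                ν-inj (proj₁ (Pairing.injective D-pairing (ν∈D 0) d (ν∈D 1) (g∈ (y∈ , ¬e)) eq))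
          ...   | ()
          h-inj {x} {y} x∈ y∈ eq | no ¬d | yes e with
                ν-inj (proj₁ (Pairing.injective D-pairing (ν∈D 1) (g∈ (x∈ , ¬d)) (ν∈D 0) e eq))
          ...   | ()
          h-inj {x} {y} x∈ y∈ eq | no ¬d | no ¬e = g-inj (x∈ , ¬d) (y∈ , ¬e)
            (proj₂ (Pairing.injective D-pairing (ν∈D 1) (g∈ (x∈ , ¬d)) (ν∈D 1) (g∈ (y∈ , ¬e)) eq))

      -- This is |B × B| ≤ |B| for infinite B. Let `D` be the domain of a maximal pairing. If the
      -- complement of `D` in `B` embeds in `D`, so does `B`, and the pairing transfers to `B`.
      -- Otherwise comparability embeds `D` in the complement, which contradicts maximality.
      infinite⇒pairing : Pairing B
      infinite⇒pairing with maximal Φ Φ-mono R₀-coherent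
      ... | R , R₀⊆R , R-coh , R-max = conclude (≼-total (λ x → B x × ¬ D x) D)
        where
        open MaximalGraph R₀⊆R R-coh R-max

        conclude : (λ x → B x × ¬ D x) ≼ D ⊎ D ≼ (λ x → B x × ¬ D x) → Pairing B
        conclude (inj₁ B∖D≼D) = ≼-pairing D⊆B (B≼D B∖D≼D) D-pairing
        conclude (inj₂ (_ , g∈ , g-inj)) = ⊥-elim (Enlarge.impossible g∈ g-inj)

-- Satisfaction of formulas

∃-cong-⇔ : ∀ {a b c} {A : Set a} {B : A → Set b} {C : A → Set c} →
           (∀ x → B x ⇔ C x) → ∃ B ⇔ ∃ C
∃-cong-⇔ eq = mk⇔ (map₂ (to (eq _))) (map₂ (from (eq _)))

∀-cong-⇔ : ∀ {a b c} {A : Set a} {B : A → Set b} {C : A → Set c} →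
           (∀ x → B x ⇔ C x) → (∀ x → B x) ⇔ (∀ x → C x)
∀-cong-⇔ eq = mk⇔ (λ f x → to (eq x) (f x)) (λ f x → from (eq x) (f x))

swap : ∀ m n → Fin (m ℕ.+ n) → Fin (n ℕ.+ m)
swap m n i = [ n ↑ʳ_ , _↑ˡ m ]′ (splitAt m i)

module _ {ℓ} {L : Signature ℓ} where
  open Signature L

  module _ {p} {P : Set p} where

    paramsᵗ : ∀ {n} → Term L P n → List P
    paramsᵗ (var i)    = []ˡ
    paramsᵗ (par c)    = c ∷ˡ []ˡ
    paramsᵗ (fun f ts) = concat (tabulate (λ i → paramsᵗ (ts i)))

    paramsᶠ : ∀ {n} → Formula L P n → List P
    paramsᶠ (s ≐ t)    = paramsᵗ s ++ˡ paramsᵗ t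
    paramsᶠ (rel r ts) = concat (tabulate (λ i → paramsᵗ (ts i)))
    paramsᶠ ⊤′         = []ˡ
    paramsᶠ ⊥′         = []ˡ
    paramsᶠ (¬′ φ)     = paramsᶠ φ
    paramsᶠ (φ ∧′ ψ)   = paramsᶠ φ ++ˡ paramsᶠ ψ
    paramsᶠ (φ ∨′ ψ)   = paramsᶠ φ ++ˡ paramsᶠ ψ
    paramsᶠ (∃′ φ)     = paramsᶠ φ
    paramsᶠ (∀′ φ)     = paramsᶠ φ

    module _ {q} {Q : Set q} {k} (r : P → Fin k) where

      -- The new variables come last: as `suc n ℕ.+ k` computes to `suc (n ℕ.+ k)`, the map `r`
      -- stays the same under binders.
      abstractᵗ : ∀ {n} → Term L P n → Term L Q (n ℕ.+ k)
      abstractᵗ (var i)    = var (i ↑ˡ k)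
      abstractᵗ (par c)    = var (_ ↑ʳ r c)
      abstractᵗ (fun f ts) = fun f (λ i → abstractᵗ (ts i))

      abstractᶠ : ∀ {n} → Formula L P n → Formula L Q (n ℕ.+ k)
      abstractᶠ (s ≐ t)    = abstractᵗ s ≐ abstractᵗ t
      abstractᶠ (rel r ts) = rel r (λ i → abstractᵗ (ts i))
      abstractᶠ ⊤′         = ⊤′
      abstractᶠ ⊥′         = ⊥′
      abstractᶠ (¬′ φ)     = ¬′ abstractᶠ φ
      abstractᶠ (φ ∧′ ψ)   = abstractᶠ φ ∧′ abstractᶠ ψ
      abstractᶠ (φ ∨′ ψ)   = abstractᶠ φ ∨′ abstractᶠ ψ
      abstractᶠ (∃′ φ)     = ∃′ abstractᶠ φ
      abstractᶠ (∀′ φ)     = ∀′ abstractᶠ φ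

    infix 9 ∃^_

    ∃^_ : ∀ n {m} → Formula L P (n ℕ.+ m) → Formula L P m
    (∃^ zero)  φ = φ
    (∃^ suc n) φ = (∃^ n) (∃′ φ)

    -- The formula ∃ y φ(x , y). As the quantifiers bind the first variables, `swap` puts the block
    -- y in front of x.
    project : ∀ m n → Formula L P (m ℕ.+ n) → Formula L P m
    project m n φ = (∃^ n) (mapᶠ id (swap m n) φ)

  module _ (𝒩 : Structure L) where
    open Structure 𝒩
    private module D = Setoid Domain

    rel-⇔ : ∀ {k} (r : Rel k) {a b : Vector Carrier k} → (∀ i → a i ≈ b i) → ⟦rel⟧ r a ⇔ ⟦rel⟧ r b
    rel-⇔ r a≈b = mk⇔ (rel-resp r a≈b) (rel-resp r (D.sym ∘ a≈b))

    ≈-⇔ : ∀ {a b c d} → a ≈ b → c ≈ d → (a ≈ c) ⇔ (b ≈ d)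
    ≈-⇔ a≈b c≈d = mk⇔ (λ a≈c → D.trans (D.sym a≈b) (D.trans a≈c c≈d))
                      (λ b≈d → D.trans a≈b (D.trans b≈d (D.sym c≈d)))

    module _ {p q} {P : Set p} {Q : Set q} {ρ : P → Carrier} {σ : Q → Carrier}
             (g : P → Q) (σg≈ρ : ∀ c → σ (g c) ≈ ρ c) where

      eval-map : ∀ {m n} (f : Fin m → Fin n) {v w} → (∀ i → w (f i) ≈ v i) →
                 ∀ t → eval 𝒩 σ w (mapᵗ g f t) ≈ eval 𝒩 ρ v t
      eval-map f eq (var i)    = eq i
      eval-map f eq (par c)    = σg≈ρ c
      eval-map f eq (fun h ts) = fun-cong h (λ i → eval-map f eq (ts i))

      lift-≈ : ∀ {m n} {f : Fin m → Fin n} {v w} → (∀ i → w (f i) ≈ v i) →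
               ∀ a i → (a ∷ w) (lift {L = L} f i) ≈ (a ∷ v) i
      lift-≈ eq a zero    = D.refl
      lift-≈ eq a (suc i) = eq i

      Sat-map : ∀ {m n} (f : Fin m → Fin n) {v w} → (∀ i → w (f i) ≈ v i) →
                ∀ φ → Sat 𝒩 σ w (mapᶠ g f φ) ⇔ Sat 𝒩 ρ v φ
      Sat-map f eq (s ≐ t)    = ≈-⇔ (eval-map f eq s) (eval-map f eq t)
      Sat-map f eq (rel r ts) = rel-⇔ r (λ i → eval-map f eq (ts i))
      Sat-map f eq ⊤′         = ⇔-id _
      Sat-map f eq ⊥′         = ⇔-id _
      Sat-map f eq (¬′ φ)     = ¬-cong-⇔ (Sat-map f eq φ)
      Sat-map f eq (φ ∧′ ψ)   = Sat-map f eq φ ×-⇔ Sat-map f eq ψ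
      Sat-map f eq (φ ∨′ ψ)   = Sat-map f eq φ ⊎-⇔ Sat-map f eq ψ
      Sat-map f eq (∃′ φ)     = ∃-cong-⇔ λ a → Sat-map (lift {L = L} f) (lift-≈ eq a) φ
      Sat-map f eq (∀′ φ)     = ∀-cong-⇔ λ a → Sat-map (lift {L = L} f) (lift-≈ eq a) φ

    module _ {p} {P : Set p} where

      Sat-cong : ∀ {ρ : P → Carrier} {n} {v w : Vector Carrier n} →
                 (∀ i → v i ≈ w i) → ∀ φ → Sat 𝒩 ρ v φ → Sat 𝒩 ρ w φ
      -- The formula `mapᶠ id id φ`, which need not compute to `φ`, is the intermediary: it is
      -- compared with `φ` once at `v` alone and once across `v` and `w`.
      Sat-cong v≈w φ = to (Sat-map id (λ _ → D.refl) id v≈w φ) ∘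
                       from (Sat-map id (λ _ → D.refl) id (λ _ → D.refl) φ)

      Sat-selfEq : ∀ {ρ : P → Carrier} {k n} (f : Fin k → Fin n) {v} →
                   Sat 𝒩 ρ v (selfEq {P = P} f)
      Sat-selfEq {k = zero}  f = _
      Sat-selfEq {k = suc k} f = D.refl , Sat-selfEq (f ∘ suc)

      module _ {ρ : P → Carrier} {m} {a : Vector Carrier m} where

        Sat-∃^ : ∀ n (φ : Formula L P (n ℕ.+ m)) →
                 Sat 𝒩 ρ a ((∃^ n) φ) ⇔ (∃ λ b → Sat 𝒩 ρ (b ++ a) φ)
        Sat-∃^ zero φ    = mk⇔ (λ s → [] , s) proj₂
        Sat-∃^ (suc n) φ = mk⇔
          (λ s → let b , c , s′ = to (Sat-∃^ n (∃′ φ)) s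
                 in c ∷ b , Sat-cong (∷-++ c b) φ s′)
          (λ (b , s) → from (Sat-∃^ n (∃′ φ)) (b ∘ suc , b zero ,
            Sat-cong (λ i → D.trans (D.reflexive (++-head b i))
                                    (D.sym (∷-++ (b zero) (b ∘ suc) i))) φ s))
          where
          ∷-++ : ∀ c b i → (c ∷ (b ++ a)) i ≈ ((c ∷ b) ++ a) i
          ∷-++ c b zero    = D.refl
          ∷-++ c b (suc i) with splitAt n i
          ... | inj₁ _ = D.refl
          ... | inj₂ _ = D.refl

          ++-head : ∀ (b : Vector Carrier (suc n)) i → (b ++ a) i ≡ ((b zero ∷ (b ∘ suc)) ++ a) i
          ++-head b i with splitAt (suc n) i
          ... | inj₁ zero    = refl
          ... | inj₁ (suc _) = refl
          ... | inj₂ _       = refl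

        Sat-project : ∀ n (φ : Formula L P (m ℕ.+ n)) →
                      Sat 𝒩 ρ a (project m n φ) ⇔ (∃ λ b → Sat 𝒩 ρ (a ++ b) φ)
        Sat-project n φ =
          ∃-cong-⇔ (λ b → Sat-map id (λ _ → D.refl) (swap m n) (swap-≈ b) φ) ⇔-∘
          Sat-∃^ n (mapᶠ id (swap m n) φ)
          where
          swap-≈ : ∀ b i → (b ++ a) (swap m n i) ≈ (a ++ b) i
          swap-≈ b i with splitAt m i
          ... | inj₁ j = D.reflexive (lookup-++ʳ b a j)
          ... | inj₂ j = D.reflexive (lookup-++ˡ b a j)

      module _ {q} {Q : Set q} {k} (r : P → Fin k) {ρ : P → Carrier} {σ : Q → Carrier} where

        eval-abstract : ∀ {n} {v : Vector Carrier n} {w} →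
          (∀ i → w (i ↑ˡ k) ≈ v i) →
          ∀ t → (∀ {c} → c ∈ paramsᵗ t → w (n ↑ʳ r c) ≈ ρ c) →
          eval 𝒩 σ w (abstractᵗ r t) ≈ eval 𝒩 ρ v t
        eval-abstract eq (var i)    eq′ = eq i
        eval-abstract eq (par c)    eq′ = eq′ (here refl)
        eval-abstract eq (fun f ts) eq′ = fun-cong f λ i → eval-abstract eq (ts i)
          λ c∈ → eq′ (∈-concat⁺′ c∈ (∈-tabulate⁺ i))

        extend : ∀ {n} {v : Vector Carrier n} {w} → (∀ i → w (i ↑ˡ k) ≈ v i) →
                 ∀ a i → (a ∷ w) (i ↑ˡ k) ≈ (a ∷ v) i
        extend eq a zero    = D.refl
        extend eq a (suc i) = eq i

        -- Agreement with `ρ` is demanded only for the parameters that occur in `φ`. These are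
        -- finitely many, so a finite tuple can supply them.
        Sat-abstract : ∀ {n} {v : Vector Carrier n} {w} →
          (∀ i → w (i ↑ˡ k) ≈ v i) →
          ∀ φ → (∀ {c} → c ∈ paramsᶠ φ → w (n ↑ʳ r c) ≈ ρ c) →
          Sat 𝒩 σ w (abstractᶠ r φ) ⇔ Sat 𝒩 ρ v φ
        Sat-abstract eq (s ≐ t)    eq′ = ≈-⇔ (eval-abstract eq s (eq′ ∘ ∈-++⁺ˡ))
                                             (eval-abstract eq t (eq′ ∘ ∈-++⁺ʳ (paramsᵗ s)))
        Sat-abstract eq (rel r ts) eq′ = rel-⇔ r λ i → eval-abstract eq (ts i)
          λ c∈ → eq′ (∈-concat⁺′ c∈ (∈-tabulate⁺ i))
        Sat-abstract eq ⊤′         eq′ = mk⇔ _ _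
        Sat-abstract eq ⊥′         eq′ = mk⇔ (λ ()) (λ ())
        Sat-abstract eq (¬′ φ)     eq′ = ¬-cong-⇔ (Sat-abstract eq φ eq′)
        Sat-abstract eq (φ ∧′ ψ)   eq′ = Sat-abstract eq φ (eq′ ∘ ∈-++⁺ˡ) ×-⇔
                                         Sat-abstract eq ψ (eq′ ∘ ∈-++⁺ʳ (paramsᶠ φ))
        Sat-abstract eq (φ ∨′ ψ)   eq′ = Sat-abstract eq φ (eq′ ∘ ∈-++⁺ˡ) ⊎-⇔
                                         Sat-abstract eq ψ (eq′ ∘ ∈-++⁺ʳ (paramsᶠ φ))
        Sat-abstract eq (∃′ φ)     eq′ = ∃-cong-⇔ λ a → Sat-abstract (extend eq a) φ eq′
        Sat-abstract eq (∀′ φ)     eq′ = ∀-cong-⇔ λ a → Sat-abstract (extend eq a) φ eq′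

-- The Löwenheim–Skolem theorem

data Tree {k} (K : Set k) : Set k where
  leaf : ℕ → K → Tree K
  node : Tree K → Tree K → Tree K

module _ {k} {K : Set k} where

  Leaves : ∀ {b} → Pred K b → Tree K → Set b
  Leaves B (leaf _ c) = B c
  Leaves B (node s t) = Leaves B s × Leaves B t

  module _ (c₀ : K) where

    fromVector : ∀ {n} → Vector (Tree K) n → Tree K
    fromVector {zero}  ts = leaf 0 c₀
    fromVector {suc n} ts = node (ts zero) (fromVector (ts ∘ suc))

    Leaves-fromVector : ∀ {b} {B : Pred K b} → B c₀ → ∀ {n} {ts : Vector (Tree K) n} →
                        (∀ i → Leaves B (ts i)) → Leaves B (fromVector ts)
    Leaves-fromVector c₀∈ {zero}  ts∈ = c₀∈
    Leaves-fromVector c₀∈ {suc n} ts∈ = ts∈ zero , Leaves-fromVector c₀∈ (ts∈ ∘ suc)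

module Models (em : ∀ {a} → ExcludedMiddle a) (zorn : ∀ {a b c d} → ZornsLemma a b c d) where
  open Classical em zorn
  open Cardinals em zorn

  module _ {k} {K : Set k} {b} {B : Pred K b} (p : Pairing B)
           (ν : ℕ → K) (ν∈B : ∀ i → B (ν i))
           (ν-inj : ∀ {i j} → ν i ≡ ν j → i ≡ j) where
    open Pairing p

    code : Tree K → K
    code (leaf i c) = ⟨ ν (suc i) , c ⟩
    code (node s t) = ⟨ ν 0 , ⟨ code s , code t ⟩ ⟩

    code-closed : ∀ t → Leaves B t → B (code t)
    code-closed (leaf i c) c∈        = closed (ν∈B _) c∈
    code-closed (node s t) (s∈ , t∈) =
      closed (ν∈B 0) (closed (code-closed s s∈) (code-closed t t∈))

    code-injective : ∀ s t → Leaves B s → Leaves B t → code s ≡ code t → s ≡ t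
    code-injective (leaf i c) (leaf j d) c∈ d∈ eq
      with injective (ν∈B _) c∈ (ν∈B _) d∈ eq
    ... | eq₁ , refl with ν-inj eq₁
    ...   | refl = refl
    code-injective (leaf i c) (node s t) c∈ (s∈ , t∈) eq
      with ν-inj (proj₁ (injective (ν∈B _) c∈ (ν∈B _)
             (closed (code-closed s s∈) (code-closed t t∈)) eq))
    ... | ()
    code-injective (node s t) (leaf i c) (s∈ , t∈) c∈ eq
      with ν-inj (proj₁ (injective (ν∈B _)
             (closed (code-closed s s∈) (code-closed t t∈)) (ν∈B _) c∈ eq))
    ... | ()
    code-injective (node s t) (node s′ t′) (s∈ , t∈) (s′∈ , t′∈) eq =
      let b = code-closed s s∈ ; b′ = code-closed s′ s′∈
          d = code-closed t t∈ ; d′ = code-closed t′ t′∈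
          eq₁ , eq₂ = injective b d b′ d′
                        (proj₂ (injective (ν∈B 0) (closed b d) (ν∈B 0) (closed b′ d′) eq))
      in cong₂ node (code-injective s s′ s∈ s′∈ eq₁) (code-injective t t′ t∈ t′∈ eq₂)

  module _ {ℓ} {L : Signature ℓ} (𝒰 : Structure L) where
    open Signature L
    open Structure 𝒰
    private module D = Setoid Domain

    module _ {M : Subset 𝒰} (el : IsElementarySubmodel 𝒰 M) where
      open IsElementarySubmodel el

      private
        𝓜 : Structure L
        𝓜 = induced 𝒰 M point closed

      module _ {p} {P : Set p} (ρ : P → ∃ M) where

        -- The finitely many parameters are replaced by variables.
        elementary-param : ∀ {n} (φ : Formula L P n) (a : Vector (∃ M) n) →
          Sat 𝓜 ρ a φ ⇔ Sat 𝒰 (proj₁ ∘ ρ) (proj₁ ∘ a) φ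
        elementary-param {n} φ a =
          Sat-abstract 𝒰 r a-≈ φ (D.reflexive ∘ cong proj₁ ∘ w-r)
          ⇔-∘ (elementary (abstractᶠ r φ) (a ++ w)
          ⇔-∘ ⇔-sym (Sat-abstract 𝓜 r a-≈ φ (D.reflexive ∘ cong proj₁ ∘ w-r)))
          where
          w : Vector (∃ M) (suc (length (paramsᶠ φ)))
          -- Index zero, filled with `point`, is where `r` sends the parameters that do not occur in
          -- `φ`.
          w = point ∷ (ρ ∘ List.lookup (paramsᶠ φ))

          a-≈ : ∀ i → proj₁ ((a ++ w) (i ↑ˡ suc (length (paramsᶠ φ)))) ≈ proj₁ (a i)
          a-≈ i = D.reflexive (cong proj₁ (lookup-++ˡ a w i))

          r : P → Fin (suc (length (paramsᶠ φ)))
          r c with em {P = c ∈ paramsᶠ φ}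
          ... | yes c∈ = suc (Any.index c∈)
          ... | no  _  = zero

          w-r : ∀ {c} → c ∈ paramsᶠ φ → (a ++ w) (n ↑ʳ r c) ≡ ρ c
          w-r {c} c∈ = trans (lookup-++ʳ a w (r c)) lemma
            where
            lemma : w (r c) ≡ ρ c
            lemma with em {P = c ∈ paramsᶠ φ}
            ... | yes c∈′ = cong ρ (sym (lookup-index c∈′))
            ... | no  c∉  = contradiction c∈ c∉

        -- By elementarity the existential statement passes from `𝒰` to the submodel. A witness
        -- found there lies in `M`, and elementarity takes it back to `𝒰`.
        project-witness : ∀ {m n} (φ : Formula L P (m ℕ.+ n)) (a : Vector (∃ M) m) →
          Sat 𝒰 (proj₁ ∘ ρ) (proj₁ ∘ a) (project m n φ) →
          ∃ λ b → Sat 𝒰 (proj₁ ∘ ρ) (proj₁ ∘ (a ++ b)) φ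
        project-witness {m} {n} φ a s =
          let b , s′ = to (Sat-project 𝓜 n φ) (from (elementary-param (project m n φ) a) s)
          in b , to (elementary-param φ (a ++ b)) s′

    module _ {M : Subset 𝒰} (M-resp : ∀ {x y} → x ≈ y → M x → M y) (point : ∃ M)
             (test : ∀ {n} (φ : Formula L Poly.⊥ (suc n)) (a : Vector (∃ M) n) →
                (∃ λ x → Sat₀ 𝒰 (x ∷ (proj₁ ∘ a)) φ) →
                ∃ λ x → M x × Sat₀ 𝒰 (x ∷ (proj₁ ∘ a)) φ) where

      tarski-vaught : IsElementarySubmodel 𝒰 M
      tarski-vaught = record
        { point      = point
        ; closed     = closed
        ; elementary = elementary
        }
        where
        closed : ∀ {k} (f : Fun k) (a : Vector Carrier k) → (∀ i → M (a i)) → M (⟦fun⟧ f a)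
        closed f a a∈ =
          let x , x∈ , eq = test (var zero ≐ fun f (λ i → var (suc i)))
                                 (λ i → a i , a∈ i) (_ , D.refl)
          in M-resp eq x∈

        𝓜 : Structure L
        𝓜 = induced 𝒰 M point closed

        eval-𝓜 : ∀ {n} (a : Vector (∃ M) n) (t : Term L Poly.⊥ n) →
                 proj₁ (eval 𝓜 (λ ()) a t) ≈ eval 𝒰 (λ ()) (proj₁ ∘ a) t
        eval-𝓜 a (var i)    = D.refl
        eval-𝓜 a (fun f ts) = fun-cong f (λ i → eval-𝓜 a (ts i))

        ∷-≈ : ∀ {n} x (a : Vector (∃ M) n) i → proj₁ ((x ∷ a) i) ≈ (proj₁ x ∷ (proj₁ ∘ a)) i
        ∷-≈ x a zero    = D.refl
        ∷-≈ x a (suc i) = D.refl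

        elementary : ∀ {n} (φ : Formula L Poly.⊥ n) (a : Vector (∃ M) n) →
                     Sat₀ 𝓜 a φ ⇔ Sat₀ 𝒰 (proj₁ ∘ a) φ
        elementary (s ≐ t)    a = ≈-⇔ 𝒰 (eval-𝓜 a s) (eval-𝓜 a t)
        elementary (rel r ts) a = rel-⇔ 𝒰 r (λ i → eval-𝓜 a (ts i))
        elementary ⊤′         a = ⇔-id _
        elementary ⊥′         a = ⇔-id _
        elementary (¬′ φ)     a = ¬-cong-⇔ (elementary φ a)
        elementary (φ ∧′ ψ)   a = elementary φ a ×-⇔ elementary ψ a
        elementary (φ ∨′ ψ)   a = elementary φ a ⊎-⇔ elementary ψ a
        elementary (∃′ φ)     a = mk⇔
          (λ (x , s) → proj₁ x , Sat-cong 𝒰 (∷-≈ x a) φ (to (elementary φ (x ∷ a)) s))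
          (λ s → let x , x∈ , s′ = test φ a s in
                 (x , x∈) , from (elementary φ ((x , x∈) ∷ a))
                              (Sat-cong 𝒰 (λ i → D.sym (∷-≈ (x , x∈) a i)) φ s′))
        elementary (∀′ φ)     a = mk⇔
          (λ s x → by-contradiction λ ¬s →
             let y , y∈ , ¬s′ = test (¬′ φ) a (x , ¬s) in
             ¬s′ (Sat-cong 𝒰 (∷-≈ (y , y∈) a) φ (to (elementary φ ((y , y∈) ∷ a)) (s (y , y∈)))))
          (λ s x → from (elementary φ (x ∷ a))
                     (Sat-cong 𝒰 (λ i → D.sym (∷-≈ x a i)) φ (s (proj₁ x))))

    LangSize : Set ℓ
    LangSize = LanguageSize {L = L}

    -- Arguments form an infinite sequence, of which a symbol of arity k reads the first k entries.
    -- Trees thus carry no arities, and symbols of the wrong kind get a default value.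
    applyFun : LangSize → (ℕ → Carrier) → Carrier
    applyFun (inj₁ (inj₁ (_ , f))) v = ⟦fun⟧ f (v ∘ toℕ)
    applyFun _                     v = nonempty

    applyRel : LangSize → (ℕ → Carrier) → Set ℓ
    applyRel (inj₁ (inj₂ (_ , r))) v = ⟦rel⟧ r (v ∘ toℕ)
    applyRel _                     v = Poly.⊥

    infixr 5 _◂_

    _◂_ : ∀ {a} {A : Set a} → A → (ℕ → A) → ℕ → A
    (a ◂ v) zero    = a
    (a ◂ v) (suc i) = v i

    -- Skolem terms and formulas as trees, interpreted without checking that
    -- they are well formed.
    module Hull {K : Set ℓ} (symbol : K → LangSize) (constant : ℕ → K → Carrier) where

      evalTree  : Tree K → (ℕ → Carrier) → Carrier
      evalTrees : Tree K → (ℕ → Carrier) → ℕ → Carrier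

      evalTree (leaf i _)           v = v i
      evalTree (node (leaf _ c) ts) v = applyFun (symbol c) (evalTrees ts v)
      evalTree (node (node _ _) _)  v = nonempty

      evalTrees (leaf _ _)  v i       = nonempty
      evalTrees (node t ts) v zero    = evalTree t v
      evalTrees (node t ts) v (suc i) = evalTrees ts v i

      SatTree : Tree K → (ℕ → Carrier) → Set ℓ
      SatTree (leaf 0 _)                     v = Poly.⊤
      SatTree (node (leaf 0 _) (node s t))   v = evalTree s v ≈ evalTree t v
      SatTree (node (leaf 1 c) ts)           v = applyRel (symbol c) (evalTrees ts v)
      SatTree (node (leaf 2 _) t)            v = ¬ SatTree t v
      SatTree (node (leaf 3 _) (node s t))   v = SatTree s v × SatTree t v
      SatTree (node (leaf 4 _) (node s t))   v = SatTree s v ⊎ SatTree t v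
      SatTree (node (leaf 5 _) t)            v = ∃ λ a → SatTree t (a ◂ v)
      SatTree (node (leaf 6 _) t)            v = ∀ a → SatTree t (a ◂ v)
      -- Besides ill-formed trees this clause covers `leaf 1`, the code of `⊥′`.
      SatTree _                              v = Poly.⊥

      -- A leaf names a generator. A node is a Skolem term: its left subtree is read as a formula in
      -- which variable zero stands for the element sought, its right subtree as a list of Skolem
      -- terms for the parameters.
      value  : Tree K → Carrier
      values : Tree K → ℕ → Carrier

      value (leaf i c)  = constant i c
      value (node t ts) = ε (λ a → SatTree t (a ◂ values ts)) nonempty

      values (leaf _ _)  i       = nonempty
      values (node t ts) zero    = value t
      values (node t ts) (suc i) = values ts i

      module _ (name : LangSize → K) (symbol-name : ∀ s → symbol (name s) ≡ s) where

        private
          c₀ : K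
          c₀ = name (inj₂ 0)

        encodeᵗ : ∀ {n} → Term L {ℓ} Poly.⊥ n → Tree K
        encodeᵗ (var i)            = leaf (toℕ i) c₀
        encodeᵗ (fun {k = k} f ts) =
          node (leaf 0 (name (inj₁ (inj₁ (k , f))))) (fromVector c₀ (λ i → encodeᵗ (ts i)))

        encodeᶠ : ∀ {n} → Formula L {ℓ} Poly.⊥ n → Tree K
        encodeᶠ (s ≐ t)            = node (leaf 0 c₀) (node (encodeᵗ s) (encodeᵗ t))
        encodeᶠ (rel {k = k} r ts) =
          node (leaf 1 (name (inj₁ (inj₂ (k , r))))) (fromVector c₀ (λ i → encodeᵗ (ts i)))
        encodeᶠ ⊤′                 = leaf 0 c₀
        encodeᶠ ⊥′                 = leaf 1 c₀
        encodeᶠ (¬′ φ)             = node (leaf 2 c₀) (encodeᶠ φ)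
        encodeᶠ (φ ∧′ ψ)           = node (leaf 3 c₀) (node (encodeᶠ φ) (encodeᶠ ψ))
        encodeᶠ (φ ∨′ ψ)           = node (leaf 4 c₀) (node (encodeᶠ φ) (encodeᶠ ψ))
        encodeᶠ (∃′ φ)             = node (leaf 5 c₀) (encodeᶠ φ)
        encodeᶠ (∀′ φ)             = node (leaf 6 c₀) (encodeᶠ φ)

        evalTrees-fromVector : ∀ {n} (ts : Vector (Tree K) n) v i →
          evalTrees (fromVector c₀ ts) v (toℕ i) ≡ evalTree (ts i) v
        evalTrees-fromVector ts v zero    = refl
        evalTrees-fromVector ts v (suc i) = evalTrees-fromVector (ts ∘ suc) v i

        values-fromVector : ∀ {n} (ts : Vector (Tree K) n) i →
          values (fromVector c₀ ts) (toℕ i) ≡ value (ts i)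
        values-fromVector ts zero    = refl
        values-fromVector ts (suc i) = values-fromVector (ts ∘ suc) i

        evalTree-encode : ∀ {n} {v} {w : Vector Carrier n} → (∀ i → v (toℕ i) ≈ w i) →
          ∀ t → evalTree (encodeᵗ t) v ≈ eval 𝒰 (λ ()) w t
        evalTree-encode eq (var i) = eq i
        evalTree-encode {v = v} eq (fun f ts)
          rewrite symbol-name (inj₁ (inj₁ (-, f))) = fun-cong f λ i →
            D.trans (D.reflexive (evalTrees-fromVector (λ i → encodeᵗ (ts i)) v i))
                    (evalTree-encode eq (ts i))

        ◂-≈ : ∀ {n} {v} {w : Vector Carrier n} → (∀ i → v (toℕ i) ≈ w i) →
              ∀ a i → (a ◂ v) (toℕ i) ≈ (a ∷ w) i
        ◂-≈ eq a zero    = D.refl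
        ◂-≈ eq a (suc i) = eq i

        SatTree-encode : ∀ {n} {v} {w : Vector Carrier n} → (∀ i → v (toℕ i) ≈ w i) →
          ∀ φ → SatTree (encodeᶠ φ) v ⇔ Sat₀ 𝒰 w φ
        SatTree-encode eq (s ≐ t) = ≈-⇔ 𝒰 (evalTree-encode eq s) (evalTree-encode eq t)
        SatTree-encode {v = v} eq (rel r ts)
          rewrite symbol-name (inj₁ (inj₂ (-, r))) = rel-⇔ 𝒰 r λ i →
            D.trans (D.reflexive (evalTrees-fromVector (λ i → encodeᵗ (ts i)) v i))
                    (evalTree-encode eq (ts i))
        SatTree-encode eq ⊤′       = ⇔-id _
        SatTree-encode eq ⊥′       = ⇔-id _
        SatTree-encode eq (¬′ φ)   = ¬-cong-⇔ (SatTree-encode eq φ)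
        SatTree-encode eq (φ ∧′ ψ) = SatTree-encode eq φ ×-⇔ SatTree-encode eq ψ
        SatTree-encode eq (φ ∨′ ψ) = SatTree-encode eq φ ⊎-⇔ SatTree-encode eq ψ
        SatTree-encode eq (∃′ φ)   = ∃-cong-⇔ λ a → SatTree-encode (◂-≈ eq a) φ
        SatTree-encode eq (∀′ φ)   = ∀-cong-⇔ λ a → SatTree-encode (◂-≈ eq a) φ

        module _ {B : Pred K ℓ} (name∈B : ∀ s → B (name s)) where

          Leaves-encodeᵗ : ∀ {n} (t : Term L Poly.⊥ n) → Leaves B (encodeᵗ t)
          Leaves-encodeᵗ (var i)    = name∈B _
          Leaves-encodeᵗ (fun f ts) =
            name∈B _ , Leaves-fromVector c₀ (name∈B _) (λ i → Leaves-encodeᵗ (ts i))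

          Leaves-encodeᶠ : ∀ {n} (φ : Formula L Poly.⊥ n) → Leaves B (encodeᶠ φ)
          Leaves-encodeᶠ (s ≐ t)    = name∈B _ , Leaves-encodeᵗ s , Leaves-encodeᵗ t
          Leaves-encodeᶠ (rel r ts) =
            name∈B _ , Leaves-fromVector c₀ (name∈B _) (λ i → Leaves-encodeᵗ (ts i))
          Leaves-encodeᶠ ⊤′         = name∈B _
          Leaves-encodeᶠ ⊥′         = name∈B _
          Leaves-encodeᶠ (¬′ φ)     = name∈B _ , Leaves-encodeᶠ φ
          Leaves-encodeᶠ (φ ∧′ ψ)   = name∈B _ , Leaves-encodeᶠ φ , Leaves-encodeᶠ ψ
          Leaves-encodeᶠ (φ ∨′ ψ)   = name∈B _ , Leaves-encodeᶠ φ , Leaves-encodeᶠ ψ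
          Leaves-encodeᶠ (∃′ φ)     = name∈B _ , Leaves-encodeᶠ φ
          Leaves-encodeᶠ (∀′ φ)     = name∈B _ , Leaves-encodeᶠ φ

          hull : Subset 𝒰
          hull x = ∃ λ t → Leaves B t × value t ≈ x

          -- In the Tarski-Vaught test, let `ts` list trees that name the parameters. Then
          -- `node (encodeᶠ φ) ts` again has its leaves in `B`, and it names a solution if there is
          -- one.
          hull-elementary : IsElementarySubmodel 𝒰 hull
          hull-elementary = tarski-vaught
            (λ x≈y (t , t∈ , eq) → t , t∈ , D.trans eq x≈y)
            (value (leaf 0 c₀) , leaf 0 c₀ , name∈B _ , D.refl)
            test
            where
            test : ∀ {n} (φ : Formula L Poly.⊥ (suc n)) (a : Vector (∃ hull) n) →
                   (∃ λ x → Sat₀ 𝒰 (x ∷ (proj₁ ∘ a)) φ) →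
                   ∃ λ x → hull x × Sat₀ 𝒰 (x ∷ (proj₁ ∘ a)) φ
            test φ a (x , s) =
              value t , (t , (Leaves-encodeᶠ φ , ts∈) , D.refl) ,
              to (SatTree-encode (◂-≈ eq _) φ)
                (ε-spec (λ x → SatTree (encodeᶠ φ) (x ◂ values ts))
                  (x , from (SatTree-encode (◂-≈ eq x) φ) s))
              where
              ts : Tree K
              ts = fromVector c₀ (λ i → proj₁ (proj₂ (a i)))

              ts∈ : Leaves B ts
              ts∈ = Leaves-fromVector c₀ (name∈B _) (λ i → proj₁ (proj₂ (proj₂ (a i))))

              t : Tree K
              t = node (encodeᶠ φ) ts

              eq : ∀ i → values ts (toℕ i) ≈ proj₁ (a i)
              eq i = D.trans (D.reflexive (values-fromVector (λ i → proj₁ (proj₂ (a i))) i))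
                             (proj₂ (proj₂ (proj₂ (a i))))

-- Smallness of elementary hulls

module SmallModels (em : ∀ {a} → ExcludedMiddle a) (zorn : ∀ {a b c d} → ZornsLemma a b c d) where
  open Classical em zorn
  open Cardinals em zorn
  open Models em zorn

  module _ {ℓ} {κ : Set ℓ} where

    record _↪_ (S : Setoid ℓ ℓ) (B : Pred κ ℓ) : Set ℓ where
      open Setoid S
      field
        embed     : Carrier → κ
        embed∈    : ∀ x → B (embed x)
        embed-inj : ∀ {x y} → embed x ≡ embed y → x ≈ y

    image : ∀ {S : Setoid ℓ ℓ} → Injection S (setoid κ) → Pred κ ℓ
    image i c = ∃ λ x → Injection.to i x ≡ c

    image-≼ : ∀ {S} (i : Injection S (setoid κ)) {B : Pred κ ℓ} → image i ≼ B → S ↪ B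
    image-≼ i {B} (f , f∈ , f-inj) = record
      { embed     = f ∘ I.to
      ; embed∈    = λ x → f∈ (x , refl)
      ; embed-inj = λ eq → I.injective (f-inj (-, refl) (-, refl) eq)
      }
      where module I = Injection i

    image-small : ∀ {S} (i : Injection S (setoid κ)) → ¬ Injection (setoid κ) S →
                  ¬ (U ≼ image i)
    image-small {S} i κ≰S (f , f∈ , f-inj) = κ≰S (record
      { to        = λ c → proj₁ (f∈ {c} _)
      ; cong      = λ { refl → Setoid.refl S }
      ; injective = λ {c} {d} eq → f-inj _ _
          (trans (sym (proj₂ (f∈ {c} _))) (trans (I.cong eq) (proj₂ (f∈ {d} _))))
      })
      where module I = Injection i

    ≼-max : (S T : Pred κ ℓ) → ¬ (U ≼ S) → ¬ (U ≼ T) →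
            ∃ λ (R : Pred κ ℓ) → S ≼ R × T ≼ R × ¬ (U ≼ R)
    ≼-max S T S-small T-small with ≼-total S T
    ... | inj₁ S≼T = T , S≼T , ≼-refl {S = T} , T-small
    ... | inj₂ T≼S = S , ≼-refl {S = S} , T≼S , S-small

  module _ {ℓ} {L : Signature ℓ} (𝒰 : Structure L) (κ : Set ℓ) where
    open Structure 𝒰
    private module D = Setoid Domain

    module _ {A M : Subset 𝒰} {B : Pred κ ℓ} (B-small : ¬ (U ≼ B))
             (eA : subsetSetoid 𝒰 A ↪ B) (eM : subsetSetoid 𝒰 M ↪ B)
             (eL : setoid (LanguageSize {L = L}) ↪ B) where
      private
        module A = _↪_ eA
        module M = _↪_ eM
        module N = _↪_ eL

        symbol : κ → LanguageSize {L = L}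
        symbol c = ε (λ s → N.embed s ≡ c) (inj₂ 0)

        -- Leaves with index zero name the elements of `A`, all others those of `M`; `ε` inverts the
        -- embeddings up to `≈`.
        constant : ℕ → κ → Carrier
        constant zero    c = ε (λ x → ∃ λ x∈ → A.embed (x , x∈) ≡ c) nonempty
        constant (suc _) c = ε (λ x → ∃ λ x∈ → M.embed (x , x∈) ≡ c) nonempty

      open Hull 𝒰 symbol constant

      private
        symbol-name : ∀ s → symbol (N.embed s) ≡ s
        symbol-name s = N.embed-inj (ε-spec (λ s′ → N.embed s′ ≡ N.embed s) (s , refl))

        H : Subset 𝒰
        H = hull N.embed symbol-name {B = B} N.embed∈

        A⊆H : A ⊆ H
        A⊆H {x} x∈ = leaf 0 (A.embed (x , x∈)) , A.embed∈ _ , A.embed-inj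
          (proj₂ (ε-spec (λ y → ∃ λ y∈ → A.embed (y , y∈) ≡ A.embed (x , x∈)) (x , x∈ , refl)))

        M⊆H : M ⊆ H
        M⊆H {x} x∈ = leaf 1 (M.embed (x , x∈)) , M.embed∈ _ , M.embed-inj
          (proj₂ (ε-spec (λ y → ∃ λ y∈ → M.embed (y , y∈) ≡ M.embed (x , x∈)) (x , x∈ , refl)))

        ν : ℕ → κ
        ν i = N.embed (inj₂ i)

        ν-inj : ∀ {i j} → ν i ≡ ν j → i ≡ j
        ν-inj = inj₂-injective ∘ N.embed-inj

        pairing : Pairing B
        pairing = infinite⇒pairing B ν (λ _ → N.embed∈ _) ν-inj

        codeᴮ : Tree κ → κ
        codeᴮ = code pairing ν (λ _ → N.embed∈ _) ν-inj

        -- A tree chosen by `ε` for an element may depend on more than its class under `≈`, whereas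
        -- an injection of setoids must respect `≈`. A maximal set of trees with pairwise
        -- inequivalent values contains exactly one tree for each class in the hull.
        Distinct : Tree κ → Tree κ → Set ℓ
        Distinct s t = Leaves B t × (value s ≈ value t → s ≡ t)

        transversal : ∃ λ R → Clique Distinct R ×
          (∀ t → Distinct t t → (∀ {s} → R s → Distinct s t × Distinct t s) → R t)
        transversal = maximal-clique Distinct

        R : Pred (Tree κ) 0ℓ
        R = proj₁ transversal

        R⊆Leaves : R ⊆ Leaves B
        R⊆Leaves r = proj₁ (proj₁ (proj₂ transversal) r r)

        R-unique : ∀ {s t} → R s → R t → value s ≈ value t → s ≡ t
        R-unique r r′ = proj₂ (proj₁ (proj₂ transversal) r r′)

        representative : Carrier → Tree κ
        representative x = ε (λ t → R t × value t ≈ x) (leaf 0 (ν 0))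

        representative-spec : ∀ {x} → H x →
          R (representative x) × value (representative x) ≈ x
        representative-spec {x} (t , t∈ , eq) =
          -- If no tree in `R` had the value `x`, the given tree `t` could be added to `R`.
          ε-spec (λ t → R t × value t ≈ x) (by-contradiction λ ∄ →
            ∄ (t , proj₂ (proj₂ transversal) t (t∈ , λ _ → refl)
              (λ {s} r → (t∈ , λ eq′ → ⊥-elim (∄ (s , r , D.trans eq′ eq)))
                       , (R⊆Leaves r , λ eq′ → ⊥-elim (∄ (s , r , D.trans (D.sym eq′) eq))))
              , eq))

        R-code-inj : ∀ {s t} → R s → R t → codeᴮ s ≡ codeᴮ t → s ≡ t
        R-code-inj {s} {t} r r′ =
          code-injective pairing ν (λ _ → N.embed∈ _) ν-inj s t (R⊆Leaves r) (R⊆Leaves r′)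

        H-small : IsSmall 𝒰 κ H
        H-small = record
            { to        = λ (x , _) → codeᴮ (representative x)
            ; cong      = λ {(x , x∈)} {(y , y∈)} x≈y →
                let r , eq = representative-spec x∈ ; r′ , eq′ = representative-spec y∈
                in cong codeᴮ (R-unique r r′ (D.trans eq (D.trans x≈y (D.sym eq′))))
            ; injective = λ {(x , x∈)} {(y , y∈)} eq″ →
                let r , eq = representative-spec x∈ ; r′ , eq′ = representative-spec y∈
                in D.trans (D.sym eq)
                     (D.trans (D.reflexive (cong value (R-code-inj r r′ eq″))) eq′)
            }
          -- Followed by the coding of representatives, an injection of `κ` into `H` would embed `κ`
          -- in `B`.
          , λ i → let module I = Injection i in B-small
              ( (λ c → codeᴮ (representative (proj₁ (I.to c))))
              , (λ {c} _ → code-closed pairing ν (λ _ → N.embed∈ _) ν-inj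
                  (representative (proj₁ (I.to c)))
                  (R⊆Leaves (proj₁ (representative-spec (proj₂ (I.to c))))))
              , λ {c} {d} _ _ eq″ →
                  let r , eq = representative-spec (proj₂ (I.to c))
                      r′ , eq′ = representative-spec (proj₂ (I.to d))
                  in I.injective (D.trans (D.sym eq)
                       (D.trans (D.reflexive (cong value (R-code-inj r r′ eq″))) eq′)))

      small-hull : ∃ λ H → IsSmall 𝒰 κ H × IsElementarySubmodel 𝒰 H × A ⊆ H × M ⊆ H
      small-hull = H , H-small , hull-elementary N.embed symbol-name {B = B} N.embed∈ , A⊆H , M⊆H

    -- Let `B` be the largest of the images of `A`, `M` and the language in `κ`. It is infinite,
    -- since the language size includes ℵ₀, and hence carries a pairing. So all trees with leaves in
    -- `B` can be coded inside `B`.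
    löwenheim-skolem : _<ᶜ_ {L = L} (setoid (LanguageSize {L = L})) κ → ∀ {A M} →
      IsSmall 𝒰 κ A → IsSmall 𝒰 κ M →
      ∃ λ H → IsSmall 𝒰 κ H × IsElementarySubmodel 𝒰 H × A ⊆ H × M ⊆ H
    löwenheim-skolem (langInj , κ≰lang) {A} {M} (i , κ≰A) (j , κ≰M)
      with ≼-max (image i) (image j) (image-small i κ≰A) (image-small j κ≰M)
    ... | C , i≼C , j≼C , C-small
      with ≼-max C (image langInj) C-small (image-small langInj κ≰lang)
    ...   | B , C≼B , L≼B , B-small = small-hull {A} {M} {B} B-small
      (image-≼ i {B} (≼-trans {S = image i} {T = C} {U = B} i≼C C≼B))
      (image-≼ j {B} (≼-trans {S = image j} {T = C} {U = B} j≼C C≼B))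
      (image-≼ langInj {B} L≼B)

-- Sums, rational numbers and cuts

module _ {a c ℓ} (M : CommutativeMonoid c ℓ) {A : Set a} where
  open CommutativeMonoid M using (Carrier; _≈_; _∙_; ε; ∙-cong; identityˡ; assoc)
    renaming (refl to ≈-refl; sym to ≈-sym; trans to ≈-trans)

  ∑ : (A → Carrier) → List A → Carrier
  ∑ f []ˡ        = ε
  ∑ f (x ∷ˡ xs) = f x ∙ ∑ f xs

  ∑-++ : ∀ f xs ys → ∑ f (xs ++ˡ ys) ≈ ∑ f xs ∙ ∑ f ys
  ∑-++ f []ˡ        ys = ≈-sym (identityˡ _)
  ∑-++ f (x ∷ˡ xs) ys = ≈-trans (∙-cong ≈-refl (∑-++ f xs ys)) (≈-sym (assoc _ _ _))

∑-map : ∀ {a b c ℓ} (M : CommutativeMonoid c ℓ) {A : Set a} {B : Set b} →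
        ∀ f (g : A → B) xs → ∑ M f (map g xs) ≡ ∑ M (f ∘ g) xs
∑-map M f g []ˡ        = refl
∑-map M f g (x ∷ˡ xs) = cong (CommutativeMonoid._∙_ M (f (g x))) (∑-map M f g xs)

fromℕ : ℕ → ℚ
fromℕ zero    = 0ℚ
fromℕ (suc n) = 1ℚ ℚ.+ fromℕ n

fromℕ-≃ : ∀ n → toℚᵘ (fromℕ n) ℚᵘ.≃ ℚᵘ.mkℚᵘ (+ n) 0
fromℕ-≃ zero    = ℚᵘₚ.≃-refl
fromℕ-≃ (suc n) = ℚᵘₚ.≃-trans (ℚₚ.toℚᵘ-homo-+ 1ℚ (fromℕ n))
  (ℚᵘₚ.≃-trans (ℚᵘₚ.+-cong {ℚᵘ.1ℚᵘ} ℚᵘₚ.≃-refl (fromℕ-≃ n))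
    (ℚᵘ.*≡* (cong (ℤ._* + 1) (cong (ℤ._+_ (+ 1)) (ℤₚ.*-identityʳ (+ n))))))

-- A nonnegative fraction is at most its numerator, a negative one at most 0.
≤-fromℕ : ∀ p → ∃ λ n → p ℚ.≤ fromℕ n
≤-fromℕ (ℚ.mkℚ (+ n) d _)       = n , ℚₚ.toℚᵘ-cancel-≤ (ℚᵘₚ.≤-respʳ-≃ (ℚᵘₚ.≃-sym (fromℕ-≃ n))
  (ℚᵘ.*≤* (ℤₚ.*-monoˡ-≤-nonNeg (+ n) (ℤ.+≤+ (ℕ.s≤s ℕ.z≤n)))))
≤-fromℕ (ℚ.mkℚ (ℤ.-[1+ _ ]) _ _) = 0 , ℚₚ.toℚᵘ-cancel-≤ (ℚᵘ.*≤* ℤ.-≤+)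

archimedean : ∀ p {ε} → 0ℚ ℚ.< ε → ∃ λ n → p ℚ.≤ fromℕ n ℚ.* ε
archimedean p {ε} 0<ε =
  let n , p/ε≤n = ≤-fromℕ (p ℚ.* 1/ε)
  in n , subst (ℚ._≤ fromℕ n ℚ.* ε) eq (ℚₚ.*-monoʳ-≤-nonNeg ε p/ε≤n)
  where
  instance
    pos    = ℚ.positive 0<ε
    nonNeg = ℚₚ.pos⇒nonNeg ε
    nonZero = ℚₚ.pos⇒nonZero ε

  1/ε : ℚ
  1/ε = ℚ.1/ ε

  eq : p ℚ.* 1/ε ℚ.* ε ≡ p
  eq = trans (ℚₚ.*-assoc p 1/ε ε)
    (trans (cong (p ℚ.*_) (ℚₚ.*-inverseˡ ε)) (ℚₚ.*-identityʳ p))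

<⇒0<- : ∀ {p q} → p ℚ.< q → 0ℚ ℚ.< q ℚ.- p
<⇒0<- {p} {q} p<q = subst (ℚ._< q ℚ.- p) (ℚₚ.+-inverseʳ p) (ℚₚ.+-monoˡ-< (ℚ.- p) p<q)

+-cancel : ∀ p q → p ℚ.+ q ℚ.- q ≡ p
+-cancel = solve 2 (λ p q → p :+ q :- q := p) refl

-- An inequality follows from another one if the two differ by an identity,
-- which the ring solver proves.
rearrange-< : ∀ {a b c d} → a ℚ.< b → c ℚ.+ b ≡ d ℚ.+ a → c ℚ.< d
rearrange-< {a} {b} {c} {d} a<b eq = subst₂ ℚ._<_ (+-cancel c a) (+-cancel d a)
  (ℚₚ.+-monoˡ-< (ℚ.- a) (subst (c ℚ.+ a ℚ.<_) eq (ℚₚ.+-monoʳ-< c a<b)))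

rearrange-≤ : ∀ {a b c d} → a ℚ.≤ b → c ℚ.+ b ≡ d ℚ.+ a → c ℚ.≤ d
rearrange-≤ {a} {b} {c} {d} a≤b eq = subst₂ ℚ._≤_ (+-cancel c a) (+-cancel d a)
  (ℚₚ.+-monoˡ-≤ (ℚ.- a) (subst (c ℚ.+ a ℚ.≤_) eq (ℚₚ.+-monoʳ-≤ c a≤b)))

cut-≤ : ∀ (r : ℝ) {p q} → p ℚ.≤ q → cut r q → cut r p
cut-≤ r {p} {q} p≤q q∈ with ℚₚ._<?_ p q
... | yes p<q = ℝ.down r p<q q∈
... | no  p≮q = subst (cut r) (ℚₚ.≤-antisym (ℚₚ.≮⇒≥ p≮q) p≤q) q∈

cut-< : ∀ (r : ℝ) {p q} → cut r p → ¬ cut r q → p ℚ.< q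
cut-< r p∈ q∉ = ℚₚ.≰⇒> (λ q≤p → q∉ (cut-≤ r q≤p p∈))

≤ᴿ-refl : ∀ {r} → r ≤ᴿ r
≤ᴿ-refl _ q∈ = q∈

+ᴿ-mono : ∀ {r r′ s s′} → r ≤ᴿ r′ → s ≤ᴿ s′ → r +ᴿ s ≤ᴿ r′ +ᴿ s′
+ᴿ-mono r≤r′ s≤s′ q (a , b , a∈ , b∈ , eq) = a , b , r≤r′ a a∈ , s≤s′ b b∈ , eq

+ᴿ-comm : ∀ r s → r +ᴿ s ≤ᴿ s +ᴿ r
+ᴿ-comm r s q (a , b , a∈ , b∈ , eq) = b , a , b∈ , a∈ , trans eq (ℚₚ.+-comm a b)

+ᴿ-identityˡ : ∀ r → 0ᴿ +ᴿ r ≈ᴿ r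
+ᴿ-identityˡ r =
  (λ { _ (a , b , a<0 , b∈ , refl) → cut-≤ r
         (subst (a ℚ.+ b ℚ.≤_) (ℚₚ.+-identityˡ b) (ℚₚ.+-monoˡ-≤ b (ℚₚ.<⇒≤ a<0))) b∈ }) ,
  (λ q q∈ → let p , q<p , p∈ = ℝ.open-end r q∈ in
     q ℚ.- p , p , rearrange-< q<p (solve 2 (λ p q → q :- p :+ p := con 0ℚ :+ q) refl p q) ,
     p∈ , solve 2 (λ p q → q := q :- p :+ p) refl p q)

+ᴿ-assoc : ∀ r s t → (r +ᴿ s) +ᴿ t ≈ᴿ r +ᴿ (s +ᴿ t)
+ᴿ-assoc r s t =
  (λ { _ (_ , c , (a , b , a∈ , b∈ , refl) , c∈ , refl) →
         a , b ℚ.+ c , a∈ , (b , c , b∈ , c∈ , refl) , ℚₚ.+-assoc a b c }) ,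
  (λ { _ (a , _ , a∈ , (b , c , b∈ , c∈ , refl) , refl) →
         a ℚ.+ b , c , (a , b , a∈ , b∈ , refl) , c∈ , sym (ℚₚ.+-assoc a b c) })

+ᴿ-0ᴿ-commutativeMonoid : CommutativeMonoid (lsuc 0ℓ) 0ℓ
+ᴿ-0ᴿ-commutativeMonoid = record
  { Carrier = ℝ
  ; _≈_     = _≈ᴿ_
  ; _∙_     = _+ᴿ_
  ; ε       = 0ᴿ
  ; isCommutativeMonoid = record
    { isMonoid = record
      { isSemigroup = record
        { isMagma = record
          { isEquivalence = record
            { refl  = (λ _ → id) , λ _ → id
            ; sym   = λ (r≤s , s≤r) → s≤r , r≤s
            ; trans = λ (r≤s , s≤r) (s≤t , t≤s) →
                (λ q → s≤t q ∘ r≤s q) , λ q → s≤r q ∘ t≤s q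
            }
          ; ∙-cong = λ {r} {r′} {s} {s′} (r≤r′ , r′≤r) (s≤s′ , s′≤s) →
              +ᴿ-mono {r} {r′} {s} {s′} r≤r′ s≤s′ , +ᴿ-mono {r′} {r} {s′} {s} r′≤r s′≤s
          }
        ; assoc = +ᴿ-assoc
        }
      ; identity = +ᴿ-identityˡ , λ r →
          (λ q → proj₁ (+ᴿ-identityˡ r) q ∘ +ᴿ-comm r 0ᴿ q) ,
          λ q → +ᴿ-comm 0ᴿ r q ∘ proj₂ (+ᴿ-identityˡ r) q
      }
    ; comm = λ r s → +ᴿ-comm r s , +ᴿ-comm s r
    }
  }

fromℚ-mono : ∀ {p q} → p ℚ.≤ q → fromℚ p ≤ᴿ fromℚ q
fromℚ-mono p≤q _ a<p = ℚₚ.<-≤-trans a<p p≤q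

fromℚ-cancel : ∀ {p q} → fromℚ p ≤ᴿ fromℚ q → p ℚ.≤ q
fromℚ-cancel p≤q = ℚₚ.≮⇒≥ (λ q<p → ℚₚ.<-irrefl refl (p≤q _ q<p))

fromℚ-+ : ∀ p q → fromℚ (p ℚ.+ q) ≈ᴿ fromℚ p +ᴿ fromℚ q
fromℚ-+ p q =
  (λ a a<p+q → let b , a-q<b , b<p = ℚₚ.<-dense (rearrange-< a<p+q
                     (solve 3 (λ a p q → a :- q :+ (p :+ q) := p :+ a) refl a p q)) in
     b , a ℚ.- b , b<p ,
     rearrange-< a-q<b (solve 3 (λ a b q → a :- b :+ b := q :+ (a :- q)) refl a b q) ,
     solve 2 (λ a b → a := b :+ (a :- b)) refl a b) ,
  (λ { _ (_ , _ , a<p , b<q , refl) → ℚₚ.+-mono-< a<p b<q })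

cut⇒fromℚ-≤ : ∀ {r q} → cut r q → fromℚ q ≤ᴿ r
cut⇒fromℚ-≤ {r} q∈ p p<q = ℝ.down r p<q q∈

∑ᴿ : ∀ {a} {A : Set a} → (A → ℝ) → List A → ℝ
∑ᴿ = ∑ +ᴿ-0ᴿ-commutativeMonoid

∑ᵠ : ∀ {a} {A : Set a} → (A → ℚ) → List A → ℚ
∑ᵠ = ∑ ℚₚ.+-0-commutativeMonoid

module _ {a} {A : Set a} where

  ∑ᴿ-mono : ∀ {f g : A → ℝ} {xs} → All (λ x → f x ≤ᴿ g x) xs → ∑ᴿ f xs ≤ᴿ ∑ᴿ g xs
  ∑ᴿ-mono []ᴬ = λ _ → id
  ∑ᴿ-mono {f} {g} {x ∷ˡ xs} (f≤g ∷ᴬ fs≤gs) =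
    +ᴿ-mono {f x} {g x} {∑ᴿ f xs} {∑ᴿ g xs} f≤g (∑ᴿ-mono fs≤gs)

  ∑ᵠ-mono : ∀ {f g : A → ℚ} {xs} → All (λ x → f x ℚ.≤ g x) xs → ∑ᵠ f xs ℚ.≤ ∑ᵠ g xs
  ∑ᵠ-mono []ᴬ              = ℚₚ.≤-refl
  ∑ᵠ-mono (f≤g ∷ᴬ fs≤gs) = ℚₚ.+-mono-≤ f≤g (∑ᵠ-mono fs≤gs)

  ∑ᵠ-minus : ∀ (f g : A → ℚ) xs →
             ∑ᵠ (λ x → f x ℚ.- g x) xs ≡ ∑ᵠ f xs ℚ.- ∑ᵠ g xs
  ∑ᵠ-minus f g []ˡ        = refl
  ∑ᵠ-minus f g (x ∷ˡ xs) = trans (cong (f x ℚ.- g x ℚ.+_) (∑ᵠ-minus f g xs))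
    (solve 4 (λ a b c d → a :- b :+ (c :- d) := a :+ c :- (b :+ d)) refl
      (f x) (g x) (∑ᵠ f xs) (∑ᵠ g xs))

  fromℚ-∑ : ∀ (f : A → ℚ) xs → fromℚ (∑ᵠ f xs) ≈ᴿ ∑ᴿ (fromℚ ∘ f) xs
  fromℚ-∑ f []ˡ        = (λ _ → id) , (λ _ → id)
  fromℚ-∑ f (x ∷ˡ xs) = let ≤∑ , ∑≤ = fromℚ-∑ f xs ; ≤+ , +≤ = fromℚ-+ (f x) (∑ᵠ f xs) in
    (λ q → +ᴿ-mono {p} {p} {s} {t} (≤ᴿ-refl {p}) ≤∑ q ∘ ≤+ q) ,
    (λ q → +≤ q ∘ +ᴿ-mono {p} {p} {t} {s} (≤ᴿ-refl {p}) ∑≤ q)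
    where
    p s t : ℝ
    p = fromℚ (f x)
    s = fromℚ (∑ᵠ f xs)
    t = ∑ᴿ (fromℚ ∘ f) xs

module Cuts (em : ∀ {a} → ExcludedMiddle a) where

  -- Excluded middle makes every cut located: upward steps of length `ε` from a member reach the
  -- nonmember `t` after finitely many steps, so one of them leaves the cut.
  cut-gap : ∀ (r : ℝ) {ε} → 0ℚ ℚ.< ε → ∃ λ s → cut r s × ¬ cut r (s ℚ.+ ε)
  cut-gap r {ε} 0<ε =
    let s , s∈ = ℝ.inhabited r ; t , t∉ = ℝ.proper r
        n , t-s≤nε = archimedean (t ℚ.- s) 0<ε
    in search n s s∈ λ t′∈ → t∉ (cut-≤ r
         (rearrange-≤ t-s≤nε
           (solve 3 (λ t s e → t :+ e := s :+ e :+ (t :- s)) refl t s (fromℕ n ℚ.* ε))) t′∈)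
    where
    search : ∀ n s → cut r s → ¬ cut r (s ℚ.+ fromℕ n ℚ.* ε) → ∃ λ s → cut r s × ¬ cut r (s ℚ.+ ε)
    search zero s s∈ s∉ =
      contradiction (subst (cut r) (solve 2 (λ s e → s := s :+ con 0ℚ :* e) refl s ε) s∈) s∉
    search (suc n) s s∈ t∉ with em {P = cut r (s ℚ.+ ε)}
    ... | no  s+ε∉ = s , s∈ , s+ε∉
    ... | yes s+ε∈ = search n (s ℚ.+ ε) s+ε∈ (t∉ ∘ subst (cut r)
      (solve 3 (λ s e n → s :+ e :+ n :* e := s :+ (con 1ℚ :+ n) :* e) refl s ε (fromℕ n)))

-- Cones of functions

0≤fromℕ : ∀ n → 0ℚ ℚ.≤ fromℕ n
0≤fromℕ zero    = ℚₚ.≤-refl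
0≤fromℕ (suc n) = ℚₚ.+-mono-≤ {0ℚ} {1ℚ} (ℚₚ.nonNegative⁻¹ 1ℚ) (0≤fromℕ n)

fromℕ-*-monoʳ-≤ : ∀ n {p q} → p ℚ.≤ q → fromℕ n ℚ.* p ℚ.≤ fromℕ n ℚ.* q
fromℕ-*-monoʳ-≤ n = ℚₚ.*-monoˡ-≤-nonNeg (fromℕ n) {{ℚ.nonNegative (0≤fromℕ n)}}

-1ℚ : ℚ
-1ℚ = ℚ.- 1ℚ

module Cones (em : ∀ {a} → ExcludedMiddle a) (zorn : ∀ {a b c d} → ZornsLemma a b c d)
             {x} {X : Set x} where
  open Classical em zorn
  open Cuts em

  record IsCone (P : Pred (X → ℚ) 0ℓ) : Set x where
    field
      nonneg : ∀ {f} → (∀ x → 0ℚ ℚ.≤ f x) → P f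
      sum    : ∀ {f g} → P f → P g → P (λ x → f x ℚ.+ g x)
      upward : ∀ {f g} → (∀ x → f x ℚ.≤ g x) → P f → P g
      proper : ∀ {f} → P f → ¬ (∀ x → f x ℚ.≤ -1ℚ)

    resp : ∀ {f g} → (∀ x → f x ≡ g x) → P f → P g
    resp f≡g = upward (ℚₚ.≤-reflexive ∘ f≡g)

    multiple : ∀ n {f} → P f → P (λ x → fromℕ n ℚ.* f x)
    multiple zero    {f} f∈ = nonneg (λ x → ℚₚ.≤-reflexive (sym (ℚₚ.*-zeroˡ (f x))))
    multiple (suc n) {f} f∈ = resp
      (λ x → solve 2 (λ f n → f :+ n :* f := (con 1ℚ :+ n) :* f) refl (f x) (fromℕ n))
      (sum f∈ (multiple n f∈))

    -- By the Archimedean property some natural multiple of `f`, again in the cone, is at most -1.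
    negative∉ : ∀ {f q} → 0ℚ ℚ.< q → (∀ x → f x ℚ.≤ ℚ.- q) → ¬ P f
    negative∉ {f} {q} 0<q f≤-q f∈ =
      let n , 1≤nq = archimedean 1ℚ 0<q
      in proper (multiple n f∈) λ x → ℚₚ.≤-trans (fromℕ-*-monoʳ-≤ n (f≤-q x))
           (rearrange-≤ 1≤nq
             (solve 2 (λ n q → n :* (:- q) :+ n :* q := :- con 1ℚ :+ con 1ℚ) refl (fromℕ n) q))

  IsTotal : Pred (X → ℚ) 0ℓ → Set x
  IsTotal P = ∀ f → P f ⊎ P (λ x → ℚ.- f x)

  private
    -- The cone axioms as conditions on pairs, for use with `maximal`. The axiom `nonneg`, which
    -- puts given functions into the cone, is inherited from the initial cone.
    Φ : Pred (X → ℚ) 0ℓ → (X → ℚ) → (X → ℚ) → Set x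
    Φ P f g = P (λ x → f x ℚ.+ g x) × (∀ {h} → (∀ x → f x ℚ.≤ h x) → P h) ×
              ¬ (∀ x → f x ℚ.≤ -1ℚ)

    cone⇒coherent : ∀ {P} → IsCone P → Coherent Φ P
    cone⇒coherent c f∈ g∈ = sum f∈ g∈ , (λ f≤h → upward f≤h f∈) , proper f∈
      where open IsCone c

    coherent⇒cone : ∀ {P₀ P} → IsCone P₀ → P₀ ⊆ P → Coherent Φ P → IsCone P
    coherent⇒cone c P₀⊆P coh = record
      { nonneg = P₀⊆P ∘ IsCone.nonneg c
      ; sum    = λ f∈ g∈ → proj₁ (coh f∈ g∈)
      ; upward = λ f≤g f∈ → proj₁ (proj₂ (coh f∈ f∈)) f≤g
      ; proper = λ f∈ → proj₂ (proj₂ (coh f∈ f∈))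
      }

    module Adjoin {P} (c : IsCone P) (f : X → ℚ) where
      open IsCone c

      -- This is failure of properness for `Adjoined`, the cone generated by `P` and `f`.
      Refutes : Set x
      Refutes = ∃ λ p → ∃ λ n → P p × (∀ x → p x ℚ.+ fromℕ n ℚ.* f x ℚ.≤ -1ℚ)

      Adjoined : Pred (X → ℚ) 0ℓ
      Adjoined g = ⌊ ∃ (λ p → ∃ λ n → P p × (∀ x → p x ℚ.+ fromℕ n ℚ.* f x ℚ.≤ g x)) ⌋

      P⊆Adjoined : P ⊆ Adjoined
      P⊆Adjoined {g} g∈ = ⌊⌋-intro (g , 0 , g∈ , λ x → ℚₚ.≤-reflexive
        (solve 2 (λ g f → g :+ con 0ℚ :* f := g) refl (g x) (f x)))

      f∈Adjoined : Adjoined f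
      f∈Adjoined = ⌊⌋-intro ((λ _ → 0ℚ) , 1 , nonneg (λ _ → ℚₚ.≤-refl) , λ x → ℚₚ.≤-reflexive
        (solve 1 (λ f → con 0ℚ :+ con 1ℚ :* f := f) refl (f x)))

      adjoined-cone : ¬ Refutes → IsCone Adjoined
      adjoined-cone ¬ref = record
        { nonneg = P⊆Adjoined ∘ nonneg
        ; sum    = sum′
        ; upward = λ g≤h g∈ → let p , n , p∈ , le = ⌈ g∈ ⌉ in
                     ⌊⌋-intro (p , n , p∈ , λ x → ℚₚ.≤-trans (le x) (g≤h x))
        ; proper = λ g∈ g≤-1 → let p , n , p∈ , le = ⌈ g∈ ⌉ in
                     ¬ref (p , n , p∈ , λ x → ℚₚ.≤-trans (le x) (g≤-1 x))
        }
        where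
        fromℕ-+ : ∀ m n → fromℕ (m ℕ.+ n) ≡ fromℕ m ℚ.+ fromℕ n
        fromℕ-+ zero    n = sym (ℚₚ.+-identityˡ (fromℕ n))
        fromℕ-+ (suc m) n =
          trans (cong (1ℚ ℚ.+_) (fromℕ-+ m n)) (sym (ℚₚ.+-assoc 1ℚ (fromℕ m) (fromℕ n)))

        sum′ : ∀ {g h} → Adjoined g → Adjoined h → Adjoined (λ x → g x ℚ.+ h x)
        sum′ {g} {h} g∈ h∈ =
          let p , m , p∈ , le = ⌈ g∈ ⌉ ; q , n , q∈ , le′ = ⌈ h∈ ⌉ in
          ⌊⌋-intro ((λ x → p x ℚ.+ q x) , m ℕ.+ n , sum p∈ q∈ , λ x →
            subst (ℚ._≤ g x ℚ.+ h x)
              (trans (solve 5 (λ p q m n f →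
                          p :+ m :* f :+ (q :+ n :* f) := p :+ q :+ (m :+ n) :* f) refl
                        (p x) (q x) (fromℕ m) (fromℕ n) (f x))
                     (cong (λ k → p x ℚ.+ q x ℚ.+ k ℚ.* f x) (sym (fromℕ-+ m n))))
              (ℚₚ.+-mono-≤ (le x) (le′ x)))

    -- Eliminate `f`: if p + n f ≤ -1 and q - K f ≤ -1 with K ≥ 1, then K p + n q ≤ -K - n ≤ -1,
    -- although K p + n q lies in `P`. For K = 0 the function `q` itself violates properness.
    ¬refutes-both : ∀ {P} (c : IsCone P) f →
                    Adjoin.Refutes c f → ¬ Adjoin.Refutes c (λ x → ℚ.- f x)
    ¬refutes-both c f _ (q , zero , q∈ , le) = IsCone.proper c q∈ λ x →
      subst (ℚ._≤ -1ℚ) (solve 2 (λ q f → q :+ con 0ℚ :* f := q) refl (q x) (ℚ.- f x)) (le x)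
    ¬refutes-both c f (p , n , p∈ , le) (q , suc k , q∈ , le′) =
      proper (sum (multiple (suc k) p∈) (multiple n q∈)) λ x → begin
        K ℚ.* p x ℚ.+ fromℕ n ℚ.* q x
          ≡⟨ solve 3 (λ a b c → a :+ b := a :+ c :+ (b :- c)) refl
               (K ℚ.* p x) (fromℕ n ℚ.* q x) (K ℚ.* (fromℕ n ℚ.* f x)) ⟩
        (K ℚ.* p x ℚ.+ K ℚ.* (fromℕ n ℚ.* f x)) ℚ.+
        (fromℕ n ℚ.* q x ℚ.- K ℚ.* (fromℕ n ℚ.* f x))
          ≡⟨ cong₂ ℚ._+_ (sym (ℚₚ.*-distribˡ-+ K (p x) (fromℕ n ℚ.* f x)))
               (solve 4 (λ q f K n → n :* q :- K :* (n :* f) := n :* (q :+ K :* (:- f))) refl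
                 (q x) (f x) K (fromℕ n)) ⟩
        K ℚ.* (p x ℚ.+ fromℕ n ℚ.* f x) ℚ.+ fromℕ n ℚ.* (q x ℚ.+ K ℚ.* (ℚ.- f x))
          ≤⟨ ℚₚ.+-mono-≤ (fromℕ-*-monoʳ-≤ (suc k) (le x)) (fromℕ-*-monoʳ-≤ n (le′ x)) ⟩
        K ℚ.* -1ℚ ℚ.+ fromℕ n ℚ.* -1ℚ
          ≤⟨ rearrange-≤ (ℚₚ.+-mono-≤ (0≤fromℕ k) (0≤fromℕ n))
               (solve 2 (λ k n → (con 1ℚ :+ k) :* con -1ℚ :+ n :* con -1ℚ :+ (k :+ n) :=
                                 con -1ℚ :+ (con 0ℚ :+ con 0ℚ)) refl (fromℕ k) (fromℕ n)) ⟩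
        -1ℚ ∎
      where
      open IsCone c
      open ℚₚ.≤-Reasoning

      K : ℚ
      K = fromℕ (suc k)

  -- A maximal cone contains every function that can be adjoined to it. If `f` cannot be adjoined,
  -- it is refuted; then its negative is not, and can be adjoined.
  total-cone : ∀ {P₀} → IsCone P₀ → ∃ λ P → P₀ ⊆ P × IsCone P × IsTotal P
  total-cone {P₀} c₀ with maximal Φ
    (λ P⊆Q (f+g , up , pr) → P⊆Q f+g , (λ f≤h → P⊆Q (up f≤h)) , pr) (cone⇒coherent c₀)
  ... | P , P₀⊆P , coh , max = P , P₀⊆P , cone , total
    where
    cone : IsCone P
    cone = coherent⇒cone c₀ P₀⊆P coh

    absorb : ∀ f → ¬ Adjoin.Refutes cone f → P f
    absorb f ¬ref = max (P⊆Adjoined) (cone⇒coherent (adjoined-cone ¬ref)) f∈Adjoined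
      where open Adjoin cone f

    total : IsTotal P
    total f with em {P = Adjoin.Refutes cone f}
    ... | no ¬ref = inj₁ (absorb f ¬ref)
    ... | yes ref = inj₂ (absorb _ (¬refutes-both cone f ref))

  -- The expectation functional of a total cone

  module Expectation {P} (cone : IsCone P) (total : IsTotal P) where
    open IsCone cone

    record Bounded : Set x where
      constructor bounded
      field
        function : X → ℚ
        0≤       : ∀ x → 0ℚ ℚ.≤ function x
        ≤1       : ∀ x → function x ℚ.≤ 1ℚ

    open Bounded

    𝔼 : Bounded → ℝ
    𝔼 (bounded f 0≤f f≤1) = record
      -- Asking for `q′` strictly above `q` keeps the cut open even where the supremum is attained.
      { cut       = λ q → ∃ λ q′ → q ℚ.< q′ × P (λ x → f x ℚ.- q′)
      ; inhabited = -1ℚ , 0ℚ , ℚₚ.negative⁻¹ -1ℚ , nonneg λ x →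
                      subst (0ℚ ℚ.≤_) (solve 1 (λ f → f := f :- con 0ℚ) refl (f x)) (0≤f x)
      ; proper    = 1ℚ , λ (q , 1<q , f-q∈) → negative∉ (<⇒0<- 1<q)
                      (λ x → rearrange-≤ (f≤1 x)
                         (solve 2 (λ f q → f :- q :+ con 1ℚ := :- (q :- con 1ℚ) :+ f) refl (f x) q))
                      f-q∈
      ; down      = λ p<q (q′ , q<q′ , f-q′∈) → q′ , ℚₚ.<-trans p<q q<q′ , f-q′∈
      ; open-end  = λ (q′ , q<q′ , f-q′∈) →
                      let p , q<p , p<q′ = ℚₚ.<-dense q<q′ in p , q<p , q′ , p<q′ , f-q′∈
      }

    𝔼-intro : ∀ {f} {r : ℝ} → (∀ {q} → cut r q → P (λ x → function f x ℚ.- q)) → r ≤ᴿ 𝔼 f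
    𝔼-intro {r = r} f-q∈ q q∈ =
      let q′ , q<q′ , q′∈ = ℝ.open-end r q∈ in q′ , q<q′ , f-q∈ q′∈

    𝔼-mono : ∀ {f g} → (∀ x → function f x ℚ.≤ function g x) → 𝔼 f ≤ᴿ 𝔼 g
    𝔼-mono f≤g _ (q′ , q<q′ , f-q′∈) =
      q′ , q<q′ , upward (λ x → ℚₚ.+-monoˡ-≤ (ℚ.- q′) (f≤g x)) f-q′∈

    𝔼-nonneg : ∀ f → 0ᴿ ≤ᴿ 𝔼 f
    𝔼-nonneg f q q<0 = 0ℚ , q<0 , nonneg λ x →
      subst (0ℚ ℚ.≤_) (solve 1 (λ f → f := f :- con 0ℚ) refl (function f x)) (0≤ f x)

    𝔼-one : ∀ {f} → (∀ x → function f x ≡ 1ℚ) → 𝔼 f ≈ᴿ 1ᴿ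
    𝔼-one {f} f≡1 =
      -- The nonmember supplied by `ℝ.proper (𝔼 f)` is `1ℚ` by definition.
      (λ q q∈ → cut-< (𝔼 f) q∈ (proj₂ (ℝ.proper (𝔼 f)))) ,
      (λ q q<1 → 1ℚ , q<1 , nonneg λ x → ℚₚ.≤-reflexive (sym (cong (ℚ._- 1ℚ) (f≡1 x))))

    -- Closure under sums gives 𝔼 f + 𝔼 g ≤ 𝔼 h. The converse uses totality: for h - q′ in `P`
    -- choose s below 𝔼 f such that f - (s + c) is not in `P`. Then (s + c) - f is in `P`, and
    -- adding h - q′ yields g - (q′ - (s + c)).
    𝔼-+ : ∀ {f g h} → (∀ x → function h x ≡ function f x ℚ.+ function g x) →
          𝔼 h ≈ᴿ 𝔼 f +ᴿ 𝔼 g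
    𝔼-+ {f} {g} {h} h≡f+g = split , λ { _ (_ , _ , (a , <a , f-a∈) , (b , <b , g-b∈) , refl) →
        a ℚ.+ b , ℚₚ.+-mono-< <a <b , resp (sum-eq a b) (sum f-a∈ g-b∈) }
      where
      sum-eq : ∀ a b x → (function f x ℚ.- a) ℚ.+ (function g x ℚ.- b) ≡ function h x ℚ.- (a ℚ.+ b)
      sum-eq a b x = trans
        (solve 4 (λ f g a b → f :- a :+ (g :- b) := f :+ g :- (a :+ b)) refl
          (function f x) (function g x) a b)
        (cong (ℚ._- (a ℚ.+ b)) (sym (h≡f+g x)))

      difference-eq : ∀ t q x → ℚ.- (function f x ℚ.- t) ℚ.+ (function h x ℚ.- q) ≡
                                function g x ℚ.- (q ℚ.- t)
      difference-eq t q x = trans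
        (cong (λ h → ℚ.- (function f x ℚ.- t) ℚ.+ (h ℚ.- q)) (h≡f+g x))
        (solve 4 (λ f g t q → :- (f :- t) :+ (f :+ g :- q) := g :- (q :- t)) refl
          (function f x) (function g x) t q)

      half : ∀ {c} → 0ℚ ℚ.< c → 0ℚ ℚ.< ½ ℚ.* c × ½ ℚ.* c ℚ.< c
      half {c} 0<c =
        subst (ℚ._< ½ ℚ.* c) (ℚₚ.*-zeroʳ ½) (ℚₚ.*-monoʳ-<-pos ½ 0<c) ,
        subst (½ ℚ.* c ℚ.<_) (ℚₚ.*-identityˡ c)
          (ℚₚ.*-monoˡ-<-pos c {{ℚ.positive 0<c}} {½} {1ℚ} (ℚ.*<* (ℤ.+<+ (ℕ.s≤s (ℕ.s≤s ℕ.z≤n)))))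

      bound : ∀ q s c q′ → c ℚ.< q′ ℚ.- q → q ℚ.- s ℚ.< q′ ℚ.- (s ℚ.+ c)
      bound q s c q′ c<q′-q = rearrange-< c<q′-q
        (solve 4 (λ q s c q′ → q :- s :+ (q′ :- q) := q′ :- (s :+ c) :+ c) refl q s c q′)

      split-at : ∀ {q q′ c s} → P (λ x → function h x ℚ.- q′) → 0ℚ ℚ.< c → c ℚ.< q′ ℚ.- q →
                 cut (𝔼 f) s → ¬ cut (𝔼 f) (s ℚ.+ ½ ℚ.* c) → cut (𝔼 f +ᴿ 𝔼 g) q
      split-at {q} {q′} {c} {s} h-q′∈ 0<c c<q′-q s∈ s+c/2∉ =
        s , q ℚ.- s , s∈ ,
        (q′ ℚ.- (s ℚ.+ c) , bound q s c q′ c<q′-q ,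
          resp (difference-eq (s ℚ.+ c) q′) (sum s+c-f∈ h-q′∈)) ,
        solve 2 (λ q s → q := s :+ (q :- s)) refl q s
        where
        s+c-f∈ : P (λ x → ℚ.- (function f x ℚ.- (s ℚ.+ c)))
        -- If f - (s + c) were in `P`, every number strictly below s + c would lie in the cut,
        -- including s + ½ c. This is why the gap is only half of `c`.
        s+c-f∈ = [ (λ f-s-c∈ → contradiction
                     (s ℚ.+ c , ℚₚ.+-monoʳ-< s (proj₂ (half 0<c)) , f-s-c∈) s+c/2∉)
                 , id ]′ (total (λ x → function f x ℚ.- (s ℚ.+ c)))

      split : 𝔼 h ≤ᴿ 𝔼 f +ᴿ 𝔼 g
      split q (q′ , q<q′ , h-q′∈) =
        let c , 0<c , c<q′-q = ℚₚ.<-dense (<⇒0<- q<q′)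
            s , s∈ , s+c/2∉ = cut-gap (𝔼 f) (proj₁ (half 0<c))
        in split-at h-q′∈ 0<c c<q′-q s∈ s+c/2∉

    -- Lower bounds r and s for complementary functions are attained as soon
    -- as they add up to 1.
    𝔼-unique : ∀ {f g h} {r s : ℝ} → (∀ x → function h x ≡ function f x ℚ.+ function g x) →
               (∀ x → function h x ≡ 1ℚ) → r ≤ᴿ 𝔼 f → s ≤ᴿ 𝔼 g → 1ᴿ ≤ᴿ r +ᴿ s → 𝔼 f ≤ᴿ r
    𝔼-unique {f} {g} {h} {r} {s} h≡f+g h≡1 r≤f s≤g 1≤r+s q q∈ =
      by-contradiction λ q∉r →
        -- From a + b = 1 - (q₁ - q) and q₁ + b < 1 follows q < a, whereas a < q because `q` is not
        -- below `r`.
        let q₁ , q<q₁ , q₁∈ = ℝ.open-end (𝔼 f) q∈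
            a , b , a∈ , b∈ , eq = 1≤r+s (1ℚ ℚ.- (q₁ ℚ.- q)) (rearrange-< q<q₁
              (solve 2 (λ p q → con 1ℚ :- (p :- q) :+ p := con 1ℚ :+ q) refl q₁ q))
            q₁+b<1 = proj₁ (𝔼-one {h} h≡1) _
              (proj₂ (𝔼-+ {f} {g} {h} h≡f+g) _ (q₁ , b , q₁∈ , s≤g b b∈ , refl))
        in ℚₚ.<-asym (cut-< r a∈ q∉r) (rearrange-< q₁+b<1
             (trans (solve 3 (λ p q b → q :+ con 1ℚ := (con 1ℚ :- (p :- q)) :+ p) refl q₁ q b)
               (trans (cong (ℚ._+ q₁) eq)
                 (solve 3 (λ a b p → a :+ b :+ p := a :+ (p :+ b)) refl a b q₁))))

    𝔼-positive : ∀ {f} → 0ᴿ <ᴿ 𝔼 f → ¬ (∀ x → function f x ≡ 0ℚ)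
    𝔼-positive (q , (q′ , q<q′ , f-q′∈) , q≮0) f≡0 =
      negative∉ (ℚₚ.≤-<-trans (ℚₚ.≮⇒≥ q≮0) q<q′)
        (λ x → ℚₚ.≤-reflexive (trans (cong (ℚ._- q′) (f≡0 x)) (ℚₚ.+-identityˡ (ℚ.- q′)))) f-q′∈

-- Measures

-- A list of formulas is turned into a descending one by replacing pairs φ, ψ
-- with φ ∨ ψ, φ ∧ ψ, which preserves sums of modular functions.
module _ {ℓ p} {L : Signature ℓ} {P : Set p} {n : ℕ} where

  insert : Formula L P n → List (Formula L P n) → List (Formula L P n)
  insert φ []ˡ        = φ ∷ˡ []ˡ
  insert φ (χ ∷ˡ χs) = (φ ∨′ χ) ∷ˡ insert (φ ∧′ χ) χs

  sort : List (Formula L P n) → List (Formula L P n)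
  sort = foldr insert []ˡ

  module _ {c e} (M : CommutativeMonoid c e) where
    open CommutativeMonoid M using (_≈_; _∙_; ∙-congˡ; ∙-congʳ; assoc)
      renaming (Carrier to C; refl to ≈-refl)

    module _ (v : Formula L P n → C)
             (modular : ∀ φ ψ → (v (φ ∨′ ψ) ∙ v (φ ∧′ ψ)) ≈ (v φ ∙ v ψ)) where
      open SetoidReasoning (CommutativeMonoid.setoid M)

      ∑-insert : ∀ φ χs → ∑ M v (insert φ χs) ≈ (v φ ∙ ∑ M v χs)
      ∑-insert φ []ˡ        = ≈-refl
      ∑-insert φ (χ ∷ˡ χs) = begin
        v (φ ∨′ χ) ∙ ∑ M v (insert (φ ∧′ χ) χs) ≈⟨ ∙-congˡ (∑-insert (φ ∧′ χ) χs) ⟩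
        v (φ ∨′ χ) ∙ (v (φ ∧′ χ) ∙ ∑ M v χs)    ≈⟨ assoc _ _ _ ⟨
        (v (φ ∨′ χ) ∙ v (φ ∧′ χ)) ∙ ∑ M v χs    ≈⟨ ∙-congʳ (modular φ χ) ⟩
        (v φ ∙ v χ) ∙ ∑ M v χs                  ≈⟨ assoc _ _ _ ⟩
        v φ ∙ (v χ ∙ ∑ M v χs)                  ∎

      ∑-sort : ∀ φs → ∑ M v (sort φs) ≈ ∑ M v φs
      ∑-sort []ˡ        = ≈-refl
      ∑-sort (φ ∷ˡ φs) = begin
        ∑ M v (insert φ (sort φs)) ≈⟨ ∑-insert φ (sort φs) ⟩
        v φ ∙ ∑ M v (sort φs)      ≈⟨ ∙-congˡ (∑-sort φs) ⟩
        v φ ∙ ∑ M v φs             ∎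

  module _ (𝒩 : Structure L) (ρ : P → Structure.Carrier 𝒩) where

    infix 4 _⊑_

    _⊑_ : Formula L P n → Formula L P n → Set ℓ
    φ ⊑ ψ = ∀ v → Sat 𝒩 ρ v φ → Sat 𝒩 ρ v ψ

    Descending : List (Formula L P n) → Set _
    Descending = AllPairs (λ φ ψ → ψ ⊑ φ)

    insert-⊑ : ∀ β φ {χs} → φ ⊑ β → All (_⊑ β) χs → All (_⊑ β) (insert φ χs)
    insert-⊑ β φ φ⊑β []ᴬ               = φ⊑β ∷ᴬ []ᴬ
    insert-⊑ β φ {χ ∷ˡ _} φ⊑β (χ⊑β ∷ᴬ χs⊑β) =
      (λ v → [ φ⊑β v , χ⊑β v ]′) ∷ᴬ insert-⊑ β (φ ∧′ χ) (λ v → φ⊑β v ∘ proj₁) χs⊑β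

    -- The head `φ ∨′ χ` bounds all that follows: `φ ∧′ χ` implies it, and the entries after `χ`
    -- imply `χ`.
    insert-descending : ∀ {φ χs} → Descending χs → Descending (insert φ χs)
    insert-descending []ᴾ             = []ᴬ ∷ᴾ []ᴾ
    insert-descending {φ} {χ ∷ˡ _} (χs⊑χ ∷ᴾ desc) =
      insert-⊑ (φ ∨′ χ) (φ ∧′ χ) (λ _ → inj₁ ∘ proj₁)
        (All.map (λ χ′⊑χ v → inj₂ ∘ χ′⊑χ v) χs⊑χ) ∷ᴾ insert-descending desc

    sort-descending : ∀ φs → Descending (sort φs)
    sort-descending []ˡ        = []ᴾ
    sort-descending (φ ∷ˡ φs) = insert-descending (sort-descending φs)

-- Indicator functions and common witnesses

module Indicators (em : ∀ {a} → ExcludedMiddle a) where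

  [_] : ∀ {a} → Set a → ℚ
  [ A ] with em {P = A}
  ... | yes _ = 1ℚ
  ... | no  _ = 0ℚ

  module _ {a} {A : Set a} where

    []-yes : A → [ A ] ≡ 1ℚ
    []-yes x with em {P = A}
    ... | yes _ = refl
    ... | no ¬x = contradiction x ¬x

    []-no : ¬ A → [ A ] ≡ 0ℚ
    []-no ¬x with em {P = A}
    ... | yes x = contradiction x ¬x
    ... | no  _ = refl

    0≤[] : 0ℚ ℚ.≤ [ A ]
    0≤[] with em {P = A}
    ... | yes _ = ℚₚ.nonNegative⁻¹ 1ℚ
    ... | no  _ = ℚₚ.≤-refl

    []≤1 : [ A ] ℚ.≤ 1ℚ
    []≤1 with em {P = A}
    ... | yes _ = ℚₚ.≤-refl
    ... | no  _ = ℚₚ.nonNegative⁻¹ 1ℚ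

  module _ {a b} {A : Set a} {B : Set b} where

    []-mono : (A → B) → [ A ] ℚ.≤ [ B ]
    []-mono f with em {P = A}
    ... | yes x = ℚₚ.≤-reflexive (sym ([]-yes (f x)))
    ... | no  _ = 0≤[]

    []-modular : [ A ⊎ B ] ℚ.+ [ A × B ] ≡ [ A ] ℚ.+ [ B ]
    []-modular with em {P = A} | em {P = B}
    ... | yes x | yes y = cong₂ ℚ._+_ ([]-yes (inj₁ x)) ([]-yes (x , y))
    ... | yes x | no ¬y = cong₂ ℚ._+_ ([]-yes (inj₁ x)) ([]-no (¬y ∘ proj₂))
    ... | no ¬x | yes y = cong₂ ℚ._+_ ([]-yes (inj₂ y)) ([]-no (¬x ∘ proj₁))
    ... | no ¬x | no ¬y = cong₂ ℚ._+_ ([]-no [ ¬x , ¬y ]′) ([]-no (¬x ∘ proj₁))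

  []-cong : ∀ {a b} {A : Set a} {B : Set b} → A ⇔ B → [ A ] ≡ [ B ]
  []-cong A⇔B = ℚₚ.≤-antisym ([]-mono (to A⇔B)) ([]-mono (from A⇔B))

  []-⊎ : ∀ {a b} {A : Set a} {B : Set b} → ¬ (A × B) → [ A ⊎ B ] ≡ [ A ] ℚ.+ [ B ]
  []-⊎ {A = A} {B} disjoint = trans (sym (ℚₚ.+-identityʳ [ A ⊎ B ]))
    (trans (cong ([ A ⊎ B ] ℚ.+_) (sym ([]-no disjoint))) []-modular)

  -- In a descending family any point of the last nonempty set lies in all earlier sets; `z₀` serves
  -- if all sets are empty.
  common-witness : ∀ {f z s} {F : Set f} {Z : Set z} (S : F → Z → Set s) → Z → ∀ {φs} →
    AllPairs (λ φ ψ → ∀ z → S ψ z → S φ z) φs →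
    ∃ λ z → All (λ φ → ∃ (S φ) → S φ z) φs
  common-witness S z₀ []ᴾ = z₀ , []ᴬ
  common-witness S z₀ {φ ∷ˡ φs} (φs⊑φ ∷ᴾ desc) with common-witness S z₀ desc
  ... | z , zs with em {P = S φ z}
  ...   | yes s  = z , (λ _ → s) ∷ᴬ zs
  ...   | no  ¬s with em {P = ∃ (S φ)}
  ...     | no  ∄        = z , (λ e → contradiction e ∄) ∷ᴬ zs
  -- A nonempty later set would contain `z`, and then so would the set of `φ`. Hence all later sets
  -- are empty, and `z′` may replace `z`.
  ...     | yes (z′ , s) = z′ , (λ _ → s) ∷ᴬ empty φs⊑φ zs
    where
    empty : ∀ {ψs} → All (λ ψ → ∀ z → S ψ z → S φ z) ψs →
            All (λ ψ → ∃ (S ψ) → S ψ z) ψs → All (λ ψ → ∃ (S ψ) → S ψ z′) ψs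
    empty []ᴬ             []ᴬ         = []ᴬ
    empty (ψ⊑φ ∷ᴬ ψs⊑φ) (w ∷ᴬ ws) = (λ e → contradiction (ψ⊑φ _ (w e)) ¬s) ∷ᴬ empty ψs⊑φ ws

module Measures (em : ∀ {a} → ExcludedMiddle a) {ℓ} {L : Signature ℓ} (𝒰 : Structure L) where
  open Structure 𝒰
  private module R = CommutativeMonoid +ᴿ-0ᴿ-commutativeMonoid
  open SetoidReasoning R.setoid

  module _ {C : Subset 𝒰} {n} (μ : 𝔐 𝒰 C n) where
    open 𝔐 μ using (∼-cong; nonneg; total; additive)

    private
      m : 𝓛 𝒰 C n → ℝ
      m = ⟪ μ ⟫

      without : ∀ (φ ψ : 𝓛 𝒰 C n) → m (φ ∨′ ψ) ≈ᴿ m φ +ᴿ m (ψ ∧′ ¬′ φ)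
      without φ ψ = begin
        m (φ ∨′ ψ)
          ≈⟨ ∼-cong (λ a → mk⇔ (split a) [ inj₁ , inj₂ ∘ proj₁ ]′) ⟩
        m (φ ∨′ (ψ ∧′ ¬′ φ))
          ≈⟨ additive φ (ψ ∧′ ¬′ φ)
               (λ a → mk⇔ (λ (s , _ , ¬s) → contradiction s ¬s) (λ ())) ⟩
        m φ +ᴿ m (ψ ∧′ ¬′ φ) ∎
        where
        split : ∀ a → Realizes 𝒰 a (φ ∨′ ψ) → Realizes 𝒰 a (φ ∨′ (ψ ∧′ ¬′ φ))
        split a s with em {P = Realizes 𝒰 a φ}
        ... | yes t = inj₁ t
        ... | no ¬t = [ inj₁ , (λ u → inj₂ (u , ¬t)) ]′ s

      within : ∀ (φ ψ : 𝓛 𝒰 C n) → m ψ ≈ᴿ m (ψ ∧′ ¬′ φ) +ᴿ m (φ ∧′ ψ)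
      within φ ψ = begin
        m ψ
          ≈⟨ ∼-cong (λ a → mk⇔ (split a) [ proj₁ , proj₂ ]′) ⟩
        m ((ψ ∧′ ¬′ φ) ∨′ (φ ∧′ ψ))
          ≈⟨ additive (ψ ∧′ ¬′ φ) (φ ∧′ ψ)
               (λ a → mk⇔ (λ ((_ , ¬s) , s , _) → contradiction s ¬s) (λ ())) ⟩
        m (ψ ∧′ ¬′ φ) +ᴿ m (φ ∧′ ψ) ∎
        where
        split : ∀ a → Realizes 𝒰 a ψ → Realizes 𝒰 a ((ψ ∧′ ¬′ φ) ∨′ (φ ∧′ ψ))
        split a s with em {P = Realizes 𝒰 a φ}
        ... | yes t = inj₂ (t , s)
        ... | no ¬t = inj₁ (s , ¬t)

    -- Both sides are the sum of the measures of φ, of ψ ∧ ¬φ and of φ ∧ ψ.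
    𝔐-modular : ∀ φ ψ → m (φ ∨′ ψ) +ᴿ m (φ ∧′ ψ) ≈ᴿ m φ +ᴿ m ψ
    𝔐-modular φ ψ = begin
      m (φ ∨′ ψ) +ᴿ m (φ ∧′ ψ)
        ≈⟨ R.∙-congʳ {m (φ ∧′ ψ)} {m (φ ∨′ ψ)} {m φ +ᴿ m (ψ ∧′ ¬′ φ)} (without φ ψ) ⟩
      (m φ +ᴿ m (ψ ∧′ ¬′ φ)) +ᴿ m (φ ∧′ ψ)
        ≈⟨ R.assoc (m φ) (m (ψ ∧′ ¬′ φ)) (m (φ ∧′ ψ)) ⟩
      m φ +ᴿ (m (ψ ∧′ ¬′ φ) +ᴿ m (φ ∧′ ψ))
        ≈⟨ R.∙-congˡ {m φ} {m ψ} {m (ψ ∧′ ¬′ φ) +ᴿ m (φ ∧′ ψ)} (within φ ψ) ⟨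
      m φ +ᴿ m ψ ∎

    𝔐-mono : ∀ {φ ψ} → (∀ {a} → Realizes 𝒰 a φ → Realizes 𝒰 a ψ) → m φ ≤ᴿ m ψ
    𝔐-mono {φ} {ψ} φ⊑ψ q =
      proj₁ (∼-cong (λ a → mk⇔ [ φ⊑ψ , id ]′ inj₂)) q ∘
      proj₂ (without φ ψ) q ∘
      +ᴿ-mono {m φ} {m φ} {0ᴿ} {m (ψ ∧′ ¬′ φ)} (≤ᴿ-refl {m φ}) (nonneg (ψ ∧′ ¬′ φ)) q ∘
      proj₂ (R.identityʳ (m φ)) q

    𝔐-≤1 : ∀ φ → m φ ≤ᴿ 1ᴿ
    𝔐-≤1 φ q = proj₁ total q ∘ 𝔐-mono {φ} {⊤′} _ q

    𝔐-complement : ∀ φ → 1ᴿ ≤ᴿ m φ +ᴿ m (¬′ φ)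
    𝔐-complement φ q =
      proj₁ (additive φ (¬′ φ) (λ a → mk⇔ (λ (s , ¬s) → contradiction s ¬s) (λ ()))) q ∘
      𝔐-mono {⊤′} {φ ∨′ (¬′ φ)} (λ {a} _ → lem a) q ∘ proj₂ total q
      where
      lem : ∀ a → Realizes 𝒰 a (φ ∨′ (¬′ φ))
      lem a with em {P = Realizes 𝒰 a φ}
      ... | yes s = inj₁ s
      ... | no ¬s = inj₂ ¬s

-- Amalgamation

module Amalgamation (em : ∀ {a} → ExcludedMiddle a) (zorn : ∀ {a b c d} → ZornsLemma a b c d)
       {ℓ} {L : Signature ℓ} (𝒰 : Structure L) where
  open Classical em zorn
  open Models em zorn
  open Indicators em
  open Structure 𝒰
  open Measures em 𝒰
  private
    module D = Setoid Domain
    module R = CommutativeMonoid +ᴿ-0ᴿ-commutativeMonoid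

  ++-split : ∀ m {n} (v : Vector Carrier (m ℕ.+ n)) i → ((v ∘ (_↑ˡ n)) ++ (v ∘ (m ↑ʳ_))) i ≈ v i
  ++-split m v i with splitAt m i in eq
  ... | inj₁ j = D.reflexive (cong v (splitAt⁻¹-↑ˡ eq))
  ... | inj₂ j = D.reflexive (cong v (splitAt⁻¹-↑ʳ eq))

  module _ {A M : Subset 𝒰} (A⊆M : A ⊆ M) (el : IsElementarySubmodel 𝒰 M) {m n}
           {μ : 𝔐 𝒰 (full 𝒰) m} (fs : FinSatIn 𝒰 M μ)
           (ξ : 𝔐 𝒰 A (m ℕ.+ n))
           (compat : _≋_ 𝒰 (πˣ 𝒰 m n ⟪ ξ ⟫) (restrict 𝒰 A ⟪ μ ⟫)) where

    private
      μ⟨_⟩ : 𝓛 𝒰 (full 𝒰) m → ℝ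
      μ⟨_⟩ = ⟪ μ ⟫

      ξ⟨_⟩ : 𝓛 𝒰 A (m ℕ.+ n) → ℝ
      ξ⟨_⟩ = ⟪ ξ ⟫

      X : Set ℓ
      X = Vector (∃ M) (m ℕ.+ n)

      pt : ∃ M
      pt = IsElementarySubmodel.point el

      at : ∀ {C k} → Vector (∃ M) k → 𝓛 𝒰 C k → ℚ
      at a φ = [ Realizes 𝒰 (proj₁ ∘ a) φ ]

      xs : X → Vector (∃ M) m
      xs x = x ∘ (_↑ˡ n)

      global : ∀ {k} → 𝓛 𝒰 A k → 𝓛 𝒰 (full 𝒰) k
      global = mapᶠ (map₂ (λ _ → _)) id

      Sat-global : ∀ {k} (v : Vector Carrier k) φ → Realizes 𝒰 v (global φ) ⇔ Realizes 𝒰 v φ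
      Sat-global v = Sat-map 𝒰 (map₂ (λ _ → _)) (λ _ → D.refl) id (λ _ → D.refl)

      shadow : 𝓛 𝒰 A (m ℕ.+ n) → 𝓛 𝒰 (full 𝒰) m
      shadow χ = global (project m n χ)

      -- Every solution of χ lies over a solution of ∃ y χ, and on formulas in x over `A` the
      -- measures ξ and μ agree by `compat`.
      ξ≤shadow : ∀ χ → ξ⟨ χ ⟩ ≤ᴿ μ⟨ shadow χ ⟩
      ξ≤shadow χ q = proj₁ (compat (project m n χ)) q ∘ 𝔐-mono ξ {χ} (λ {v} s →
        from (Sat-map 𝒰 id (λ _ → D.refl) (_↑ˡ n) (λ _ → D.refl) (project m n χ))
          (from (Sat-project 𝒰 n χ) (v ∘ (m ↑ʳ_) , Sat-cong 𝒰 (λ i → D.sym (++-split m v i)) χ s)) ,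
        Sat-selfEq 𝒰 {P = ∃ A} {k = n} (m ↑ʳ_)) q

      lift-shadow : ∀ χ (a : Vector (∃ M) m) → Realizes 𝒰 (proj₁ ∘ a) (shadow χ) →
                    ∃ λ b → Realizes 𝒰 (proj₁ ∘ (a ++ b)) χ
      lift-shadow χ a s = project-witness 𝒰 el (map₂ A⊆M) χ a (to (Sat-global _ (project m n χ)) s)

      -- Finite satisfiability of μ enters here. If ψ fails at `a`, then by hypothesis it has no
      -- realization in `M`, so μ(ψ) is not positive; otherwise the bound is 1.
      μ≤at : ∀ ψ (a : Vector (∃ M) m) →
             ((∃ λ (b : Vector (∃ M) m) → Realizes 𝒰 (proj₁ ∘ b) ψ) → Realizes 𝒰 (proj₁ ∘ a) ψ) →
             μ⟨ ψ ⟩ ≤ᴿ fromℚ (at a ψ)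
      μ≤at ψ a w q q∈ with em {P = Realizes 𝒰 (proj₁ ∘ a) ψ}
      ... | yes _ = 𝔐-≤1 μ ψ q q∈
      ... | no ¬s = ℚₚ.≰⇒> λ 0≤q →
        ¬s (w (fs ψ (q , q∈ , λ q<0 → ℚₚ.<-irrefl refl (ℚₚ.≤-<-trans 0≤q q<0))))

      at-modular : ∀ {C k} (a : Vector (∃ M) k) (φ ψ : 𝓛 𝒰 C k) →
                   at a (φ ∨′ ψ) ℚ.+ at a (φ ∧′ ψ) ≡ at a φ ℚ.+ at a ψ
      at-modular a φ ψ = []-modular

      ∑ᵠ-sort : ∀ {C k} (a : Vector (∃ M) k) (φs : List (𝓛 𝒰 C k)) →
                ∑ᵠ (at a) (sort φs) ≡ ∑ᵠ (at a) φs
      ∑ᵠ-sort a = ∑-sort ℚₚ.+-0-commutativeMonoid (at a) (at-modular a)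

    private
      module Dominate (Φs : List (𝓛 𝒰 A (m ℕ.+ n))) (Ψs : List (𝓛 𝒰 (full 𝒰) m)) where

        χs : List (𝓛 𝒰 A (m ℕ.+ n))
        χs = sort Φs

        Θs : List (𝓛 𝒰 (full 𝒰) m)
        Θs = map shadow χs

        -- The shadows and `Ψs` are sorted jointly, so that a single `a` serves both.
        Γ : List (𝓛 𝒰 (full 𝒰) m)
        Γ = sort (Θs ++ˡ Ψs)

        BaseWitness : Vector (∃ M) m → Set ℓ
        BaseWitness a = All (λ γ →
          (∃ λ (b : Vector (∃ M) m) → Realizes 𝒰 (proj₁ ∘ b) γ) → Realizes 𝒰 (proj₁ ∘ a) γ) Γ

        FibreWitness : Vector (∃ M) m → Vector (∃ M) n → Set ℓ
        FibreWitness a b = All (λ χ →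
          (∃ λ c → Realizes 𝒰 (proj₁ ∘ (a ++ c)) χ) → Realizes 𝒰 (proj₁ ∘ (a ++ b)) χ) χs

        base : ∃ BaseWitness
        base = common-witness (λ γ a → Realizes 𝒰 (proj₁ ∘ a) γ) (λ _ → pt)
          (AllPairs.map (λ ψ⊑φ a → ψ⊑φ (proj₁ ∘ a)) (sort-descending 𝒰 proj₁ (Θs ++ˡ Ψs)))

        fibre : ∀ a → ∃ (FibreWitness a)
        fibre a = common-witness (λ χ b → Realizes 𝒰 (proj₁ ∘ (a ++ b)) χ) (λ _ → pt)
          (AllPairs.map (λ ψ⊑φ b → ψ⊑φ (proj₁ ∘ (a ++ b))) (sort-descending 𝒰 proj₁ Φs))

        ξ≤μ : ∑ᴿ ξ⟨_⟩ Φs ≤ᴿ ∑ᴿ μ⟨_⟩ Θs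
        ξ≤μ q = subst (λ r → cut r q) (sym (∑-map +ᴿ-0ᴿ-commutativeMonoid μ⟨_⟩ shadow χs)) ∘
          ∑ᴿ-mono {f = ξ⟨_⟩} {g = μ⟨_⟩ ∘ shadow} (All.universal ξ≤shadow χs) q ∘
          proj₂ (∑-sort +ᴿ-0ᴿ-commutativeMonoid ξ⟨_⟩ (𝔐-modular ξ) Φs) q

        module _ {a : Vector (∃ M) m} {b : Vector (∃ M) n}
                 (w : BaseWitness a) (w′ : FibreWitness a b) where
          private
            x : X
            x = a ++ b

          μ≤Γ : ∑ᴿ μ⟨_⟩ Θs +ᴿ ∑ᴿ μ⟨_⟩ Ψs ≤ᴿ fromℚ (∑ᵠ (at a) Γ)
          μ≤Γ q = proj₂ (fromℚ-∑ (at a) Γ) q ∘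
            ∑ᴿ-mono {f = μ⟨_⟩} {g = fromℚ ∘ at a} (All.map (λ {γ} → μ≤at γ a) w) q ∘
            proj₂ (∑-sort +ᴿ-0ᴿ-commutativeMonoid μ⟨_⟩ (𝔐-modular μ) (Θs ++ˡ Ψs)) q ∘
            proj₂ (∑-++ +ᴿ-0ᴿ-commutativeMonoid μ⟨_⟩ Θs Ψs) q

          -- If `a` satisfies ∃ y χ, elementarity provides some y in `M`, so χ holds at `(a , b)` by
          -- the choice of `b`.
          Θ≤Φ : ∑ᵠ (at a) Θs ℚ.≤ ∑ᵠ (at x) Φs
          Θ≤Φ = begin
            ∑ᵠ (at a) Θs
              ≡⟨ ∑-map ℚₚ.+-0-commutativeMonoid (at a) shadow χs ⟩
            ∑ᵠ (at a ∘ shadow) χs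
              ≤⟨ ∑ᵠ-mono (All.map (λ {χ} s → []-mono (s ∘ lift-shadow χ a)) w′) ⟩
            ∑ᵠ (at x) χs
              ≡⟨ ∑ᵠ-sort x Φs ⟩
            ∑ᵠ (at x) Φs ∎
            where open ℚₚ.≤-Reasoning

          Γ≤ : ∑ᵠ (at a) Γ ℚ.≤ ∑ᵠ (at x) Φs ℚ.+ ∑ᵠ (at (xs x)) Ψs
          Γ≤ = begin
            ∑ᵠ (at a) Γ
              ≡⟨ ∑ᵠ-sort a (Θs ++ˡ Ψs) ⟩
            ∑ᵠ (at a) (Θs ++ˡ Ψs)
              ≡⟨ ∑-++ ℚₚ.+-0-commutativeMonoid (at a) Θs Ψs ⟩
            ∑ᵠ (at a) Θs ℚ.+ ∑ᵠ (at a) Ψs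
              ≤⟨ ℚₚ.+-mono-≤ Θ≤Φ
                   (∑ᵠ-mono (All.universal (λ ψ → []-mono (Sat-cong 𝒰 a≈xs ψ)) Ψs)) ⟩
            ∑ᵠ (at x) Φs ℚ.+ ∑ᵠ (at (xs x)) Ψs ∎
            where
            open ℚₚ.≤-Reasoning

            a≈xs : ∀ i → proj₁ (a i) ≈ proj₁ (xs x i)
            a≈xs i = D.reflexive (cong proj₁ (sym (lookup-++ˡ a b i)))

          bound : ∑ᴿ ξ⟨_⟩ Φs +ᴿ ∑ᴿ μ⟨_⟩ Ψs ≤ᴿ fromℚ (∑ᵠ (at x) Φs ℚ.+ ∑ᵠ (at (xs x)) Ψs)
          bound q = fromℚ-mono Γ≤ q ∘ μ≤Γ q ∘
            +ᴿ-mono {∑ᴿ ξ⟨_⟩ Φs} {∑ᴿ μ⟨_⟩ Θs} {∑ᴿ μ⟨_⟩ Ψs} {∑ᴿ μ⟨_⟩ Ψs} ξ≤μ (≤ᴿ-refl {∑ᴿ μ⟨_⟩ Ψs}) q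

    dominate : ∀ Φs Ψs → ∃ λ (x : X) →
      ∑ᴿ ξ⟨_⟩ Φs +ᴿ ∑ᴿ μ⟨_⟩ Ψs ≤ᴿ fromℚ (∑ᵠ (at x) Φs ℚ.+ ∑ᵠ (at (xs x)) Ψs)
    dominate Φs Ψs = let a , w = base ; b , w′ = fibre a in a ++ b , bound w w′
      where open Dominate Φs Ψs

    -- The cone of the two measures and the amalgam

    private
      open Cones em zorn {X = X}

      record Lower {F : Set ℓ} (r : F → ℝ) : Set ℓ where
        constructor lower
        field
          formula : F
          value   : ℚ
          below   : cut (r formula) value

      open Lower

      excess : ∀ {F : Set ℓ} {r : F → ℝ} → (F → ℚ) → Lower r → ℚ
      excess f l = f (formula l) ℚ.- value l

      excesses : List (Lower ξ⟨_⟩) → List (Lower μ⟨_⟩) → X → ℚ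
      excesses Φs Ψs x = ∑ᵠ (excess (at x)) Φs ℚ.+ ∑ᵠ (excess (at (xs x))) Ψs

      ∑-lower : ∀ {F : Set ℓ} {r : F → ℝ} (φs : List (Lower r)) →
                fromℚ (∑ᵠ value φs) ≤ᴿ ∑ᴿ r (map formula φs)
      ∑-lower {r = r} φs q =
        subst (λ s → cut s q) (sym (∑-map +ᴿ-0ᴿ-commutativeMonoid r formula φs)) ∘
        ∑ᴿ-mono {f = fromℚ ∘ value} {g = r ∘ formula}
          (All.universal (λ l → cut⇒fromℚ-≤ {r (formula l)} (below l)) φs) q ∘
        proj₁ (fromℚ-∑ value φs) q

      module _ (Φs : List (Lower ξ⟨_⟩)) (Ψs : List (Lower μ⟨_⟩)) (x : X) where
        excesses-nonneg-at :
          ∑ᴿ ξ⟨_⟩ (map formula Φs) +ᴿ ∑ᴿ μ⟨_⟩ (map formula Ψs) ≤ᴿ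
            fromℚ (∑ᵠ (at x) (map formula Φs) ℚ.+ ∑ᵠ (at (xs x)) (map formula Ψs)) →
          0ℚ ℚ.≤ excesses Φs Ψs x
        excesses-nonneg-at witness = begin
          0ℚ
            ≤⟨ rearrange-≤ lower≤
                 (solve 2 (λ l u → con 0ℚ :+ u := u :- l :+ l) refl total-lower total-upper) ⟩
          total-upper ℚ.- total-lower
            ≡⟨ solve 4 (λ a b c d → a :+ b :- (c :+ d) := a :- c :+ (b :- d)) refl
                 u₁ u₂ (∑ᵠ value Φs) (∑ᵠ value Ψs) ⟩
          (u₁ ℚ.- ∑ᵠ value Φs) ℚ.+ (u₂ ℚ.- ∑ᵠ value Ψs)
            ≡⟨ cong₂ ℚ._+_ (collect (at x) Φs) (collect (at (xs x)) Ψs) ⟩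
          excesses Φs Ψs x ∎
          where
          open ℚₚ.≤-Reasoning

          u₁ u₂ total-upper total-lower : ℚ
          u₁ = ∑ᵠ (at x) (map formula Φs)
          u₂ = ∑ᵠ (at (xs x)) (map formula Ψs)
          total-upper = u₁ ℚ.+ u₂
          total-lower = ∑ᵠ value Φs ℚ.+ ∑ᵠ value Ψs

          lower≤ : total-lower ℚ.≤ total-upper
          lower≤ = fromℚ-cancel λ q → witness q ∘
            +ᴿ-mono {fromℚ (∑ᵠ value Φs)} {∑ᴿ ξ⟨_⟩ (map formula Φs)}
                    {fromℚ (∑ᵠ value Ψs)} {∑ᴿ μ⟨_⟩ (map formula Ψs)}
              (∑-lower Φs) (∑-lower Ψs) q ∘
            proj₁ (fromℚ-+ (∑ᵠ value Φs) (∑ᵠ value Ψs)) q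

          collect : ∀ {F : Set ℓ} {r : F → ℝ} (f : F → ℚ) (φs : List (Lower r)) →
                    ∑ᵠ f (map formula φs) ℚ.- ∑ᵠ value φs ≡ ∑ᵠ (excess f) φs
          collect f φs = trans
            (cong (ℚ._- ∑ᵠ value φs) (∑-map ℚₚ.+-0-commutativeMonoid f formula φs))
            (sym (∑ᵠ-minus (f ∘ formula) value φs))

      excesses-nonneg : ∀ Φs Ψs → ∃ λ x → 0ℚ ℚ.≤ excesses Φs Ψs x
      excesses-nonneg Φs Ψs =
        let x , bound = dominate (map formula Φs) (map formula Ψs)
        in x , excesses-nonneg-at Φs Ψs x bound

      P₀ : Pred (X → ℚ) 0ℓ
      P₀ f = ⌊ ∃ (λ Φs → ∃ λ Ψs → ∀ x → excesses Φs Ψs x ℚ.≤ f x) ⌋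

      P₀-cone : IsCone P₀
      P₀-cone = record
        { nonneg = λ 0≤f → ⌊⌋-intro ([]ˡ , []ˡ , 0≤f)
        ; sum    = λ f∈ g∈ → let Φs , Ψs , ≤f = ⌈ f∈ ⌉ ; Φs′ , Ψs′ , ≤g = ⌈ g∈ ⌉ in
                     ⌊⌋-intro (Φs ++ˡ Φs′ , Ψs ++ˡ Ψs′ , λ x →
                       ℚₚ.≤-trans (ℚₚ.≤-reflexive (excesses-++ Φs Φs′ Ψs Ψs′ x))
                                  (ℚₚ.+-mono-≤ (≤f x) (≤g x)))
        ; upward = λ f≤g f∈ → let Φs , Ψs , ≤f = ⌈ f∈ ⌉ in
                     ⌊⌋-intro (Φs , Ψs , λ x → ℚₚ.≤-trans (≤f x) (f≤g x))
        ; proper = λ f∈ f≤-1 → let Φs , Ψs , ≤f = ⌈ f∈ ⌉ ; x , 0≤ = excesses-nonneg Φs Ψs in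
                     ℚₚ.<-irrefl refl (ℚₚ.≤-<-trans 0≤
                       (ℚₚ.≤-<-trans (≤f x) (ℚₚ.≤-<-trans (f≤-1 x) (ℚₚ.negative⁻¹ -1ℚ))))
        }
        where
        excesses-++ : ∀ Φs Φs′ Ψs Ψs′ x → excesses (Φs ++ˡ Φs′) (Ψs ++ˡ Ψs′) x ≡
                      excesses Φs Ψs x ℚ.+ excesses Φs′ Ψs′ x
        excesses-++ Φs Φs′ Ψs Ψs′ x = trans
          (cong₂ ℚ._+_ (∑-++ ℚₚ.+-0-commutativeMonoid (excess (at x)) Φs Φs′)
                       (∑-++ ℚₚ.+-0-commutativeMonoid (excess (at (xs x))) Ψs Ψs′))
          (solve 4 (λ a b c d → a :+ b :+ (c :+ d) := a :+ c :+ (b :+ d)) refl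
            (∑ᵠ (excess (at x)) Φs) (∑ᵠ (excess (at x)) Φs′)
            (∑ᵠ (excess (at (xs x))) Ψs) (∑ᵠ (excess (at (xs x))) Ψs′))

      module _ {P : Pred (X → ℚ) 0ℓ} (P₀⊆P : P₀ ⊆ P) (P-cone : IsCone P) (P-total : IsTotal P) where
        open Expectation P-cone P-total

        indicator : 𝓛 𝒰 (full 𝒰) (m ℕ.+ n) → Bounded
        indicator χ = bounded (λ x → at x χ) (λ _ → 0≤[]) (λ _ → []≤1)

        amalgam : 𝔐 𝒰 (full 𝒰) (m ℕ.+ n)
        amalgam = record
          { ⟪_⟫      = λ χ → 𝔼 (indicator χ)
          ; ∼-cong   = λ {φ} {ψ} φ∼ψ →
              𝔼-mono {indicator φ} {indicator ψ} (λ x → []-mono (to (φ∼ψ _))) ,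
              𝔼-mono {indicator ψ} {indicator φ} (λ x → []-mono (from (φ∼ψ _)))
          ; nonneg   = λ φ → 𝔼-nonneg (indicator φ)
          ; total    = 𝔼-one {indicator ⊤′} (λ x → []-yes _)
          ; additive = λ φ ψ disjoint → 𝔼-+ {indicator φ} {indicator ψ} {indicator (φ ∨′ ψ)}
              (λ x → []-⊎ (λ s → Poly.⊥-elim (to (disjoint _) s)))
          }

        ω⟨_⟩ : 𝓛 𝒰 (full 𝒰) (m ℕ.+ n) → ℝ
        ω⟨_⟩ = ⟪ amalgam ⟫

        -- Since `τ` commutes with negation on `X`, the indicators of τ φ and τ (¬φ) add up to 1, so
        -- lower bounds for both force equality. This serves for the restriction to `A` as well as
        -- for the marginal in x.
        agrees : ∀ {C k} (ζ : 𝔐 𝒰 C k) (τ : 𝓛 𝒰 C k → 𝓛 𝒰 (full 𝒰) (m ℕ.+ n)) →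
          (∀ φ (x : X) → Realizes 𝒰 (proj₁ ∘ x) (τ (¬′ φ)) ⇔ (¬ Realizes 𝒰 (proj₁ ∘ x) (τ φ))) →
          (∀ φ → ⟪ ζ ⟫ φ ≤ᴿ ω⟨ τ φ ⟩) → ∀ φ → ω⟨ τ φ ⟩ ≈ᴿ ⟪ ζ ⟫ φ
        agrees ζ τ ¬-τ ζ≤ω φ =
          𝔼-unique {indicator (τ φ)} {indicator (τ (¬′ φ))} {indicator (τ φ ∨′ τ (¬′ φ))}
            {⟪ ζ ⟫ φ} {⟪ ζ ⟫ (¬′ φ)}
            (λ x → []-⊎ (λ (s , t) → to (¬-τ φ x) t s))
            (λ x → []-yes (by-contradiction λ ¬s → ¬s (inj₂ (from (¬-τ φ x) (¬s ∘ inj₁)))))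
            (ζ≤ω φ) (ζ≤ω (¬′ φ)) (𝔐-complement ζ φ) ,
          ζ≤ω φ

        cylinder : 𝓛 𝒰 (full 𝒰) m → 𝓛 𝒰 (full 𝒰) (m ℕ.+ n)
        cylinder ψ = mapᶠ id (_↑ˡ n) ψ ∧′ selfEq (m ↑ʳ_)

        Sat-cylinder : ∀ ψ (x : X) →
          Realizes 𝒰 (proj₁ ∘ x) (cylinder ψ) ⇔ Realizes 𝒰 (proj₁ ∘ xs x) ψ
        Sat-cylinder ψ x = mk⇔
          (λ (s , _) → to eq s) (λ s → from eq s , Sat-selfEq 𝒰 {P = ∃ (full 𝒰)} {k = n} (m ↑ʳ_))
          where
          eq : Realizes 𝒰 (proj₁ ∘ x) (mapᶠ id (_↑ˡ n) ψ) ⇔ Realizes 𝒰 (proj₁ ∘ xs x) ψ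
          eq = Sat-map 𝒰 id (λ _ → D.refl) (_↑ˡ n) (λ _ → D.refl) ψ

        amalgam-restrict : _≋_ 𝒰 (restrict 𝒰 A ⟪ amalgam ⟫) ⟪ ξ ⟫
        amalgam-restrict = agrees ξ global (λ φ x → ⇔-id _) λ φ →
          -- For q below ξ(φ) a one-element list puts φ - q into `P₀`.
          𝔼-intro {indicator (global φ)} {ξ⟨ φ ⟩} λ {q} q∈ → P₀⊆P (⌊⌋-intro
            (lower φ q q∈ ∷ˡ []ˡ , []ˡ , λ x → ℚₚ.≤-reflexive (trans
              (solve 1 (λ e → e :+ con 0ℚ :+ con 0ℚ := e) refl (at x φ ℚ.- q))
              (cong (ℚ._- q) (sym ([]-cong (Sat-global (proj₁ ∘ x) φ)))))))

        amalgam-πˣ : _≋_ 𝒰 (πˣ 𝒰 m n ⟪ amalgam ⟫) ⟪ μ ⟫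
        amalgam-πˣ = agrees μ cylinder
          (λ ψ x → ⇔-sym (¬-cong-⇔ (Sat-cylinder ψ x)) ⇔-∘ Sat-cylinder (¬′ ψ) x) λ ψ →
          𝔼-intro {indicator (cylinder ψ)} {μ⟨ ψ ⟩} λ {q} q∈ → P₀⊆P (⌊⌋-intro
            ([]ˡ , lower ψ q q∈ ∷ˡ []ˡ , λ x → ℚₚ.≤-reflexive (trans
              (solve 1 (λ e → con 0ℚ :+ (e :+ con 0ℚ) := e) refl (at (xs x) ψ ℚ.- q))
              (cong (ℚ._- q) (sym ([]-cong (Sat-cylinder ψ x)))))))

        -- If χ has no solution in `M`, its indicator vanishes on `X`, and its expectation is not
        -- positive.
        amalgam-finSat : FinSatIn 𝒰 M amalgam
        amalgam-finSat χ 0<χ = by-contradiction λ ∄ →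
          𝔼-positive {indicator χ} 0<χ (λ x → []-no (λ s → ∄ (x , s)))

    Amalgam : Set (lsuc 0ℓ ⊔ ℓ)
    Amalgam = ∃ λ (ω : 𝔐 𝒰 (full 𝒰) (m ℕ.+ n)) →
      _≋_ 𝒰 (restrict 𝒰 A ⟪ ω ⟫) ⟪ ξ ⟫ × _≋_ 𝒰 (πˣ 𝒰 m n ⟪ ω ⟫) ⟪ μ ⟫ × FinSatIn 𝒰 M ω

    private
      from-cone : (∃ λ P → P₀ ⊆ P × IsCone P × IsTotal P) → Amalgam
      from-cone (_ , P₀⊆P , cone , total) =
        amalgam P₀⊆P cone total , amalgam-restrict P₀⊆P cone total ,
        amalgam-πˣ P₀⊆P cone total , amalgam-finSat P₀⊆P cone total

    amalgamation : Amalgam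
    amalgamation = from-cone (total-cone P₀-cone)

  -- The amalgam ω restricts to ξ and projects to μ, so its marginal in y is ν. A formula of
  -- positive ν-measure thus has positive ω-measure as a formula in (x , y), and the y-part of a
  -- realization in `M` realizes it.
  finSat-transfer : ∀ {A M} → A ⊆ M → IsElementarySubmodel 𝒰 M →
    ∀ {m n} (μ : 𝔐 𝒰 (full 𝒰) m) (ν : 𝔐 𝒰 (full 𝒰) n) →
    FinSatIn 𝒰 M μ → GeqE 𝒰 A μ ν → FinSatIn 𝒰 M ν
  finSat-transfer {M = M} A⊆M el {m} {n} μ ν fs (ξ , compat , unique) ψ (q , q∈ , q≮0) =
    conclude (amalgamation A⊆M el {μ = μ} fs ξ compat)
    where
    conclude : Amalgam A⊆M el {μ = μ} fs ξ compat →
               ∃ λ (b : Vector (∃ M) n) → Realizes 𝒰 (proj₁ ∘ b) ψ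
    conclude (ω , ω≋ξ , ω≋μ , ω-fs) =
      let x , _ , s = ω-fs (selfEq (_↑ˡ n) ∧′ mapᶠ id (m ↑ʳ_) ψ)
                        (q , proj₂ (unique ω ω≋ξ ω≋μ ψ) q q∈ , q≮0)
      in x ∘ (m ↑ʳ_) , to (Sat-map 𝒰 id (λ _ → D.refl) (m ↑ʳ_) (λ _ → D.refl) ψ) s

theorem4p12 : (∀ {a} → ExcludedMiddle a) → (∀ {a b c d} → ZornsLemma a b c d) →
    ∀ {ℓ} (L : Signature ℓ) (T : Theory L) → IsComplete T →
    (𝒰 : Structure L) (κ : Set ℓ) → IsMonster 𝒰 T κ →
    (m n : ℕ) (μ : 𝔐 𝒰 (full 𝒰) m) (ν : 𝔐 𝒰 (full 𝒰) n) →
    (∀ M → IsSmall 𝒰 κ M → IsElementarySubmodel 𝒰 M →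
    FinSatIn 𝒰 M μ → GeqE 𝒰 M μ ν → FinSatIn 𝒰 M ν)
    × (FinSat 𝒰 κ μ → GeqESmall 𝒰 κ μ ν → FinSat 𝒰 κ ν)
theorem4p12 em zorn L T complete 𝒰 κ monster m n μ ν =
  (λ M small el → finSat-transfer id el μ ν) ,
  λ (M , M-small , el , fs) (A , A-small , μ≥ν) →
    enlarge fs μ≥ν (löwenheim-skolem 𝒰 κ (IsMonster.large monster) A-small M-small)
  where
  open Amalgamation em zorn 𝒰
  open SmallModels em zorn

  -- Finite satisfiability in `M` persists in the larger model `H`, and as `A ⊆ H` the transfer
  -- applies to `H`.
  enlarge : ∀ {A M} → FinSatIn 𝒰 M μ → GeqE 𝒰 A μ ν →
    (∃ λ H → IsSmall 𝒰 κ H × IsElementarySubmodel 𝒰 H × A ⊆ H × M ⊆ H) → FinSat 𝒰 κ ν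
  enlarge fs μ≥ν (H , H-small , el , A⊆H , M⊆H) =
    H , H-small , el , finSat-transfer A⊆H el μ ν
      (λ φ 0<φ → let a , s = fs φ 0<φ in map₂ M⊆H ∘ a , s) μ≥ν
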